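{- Let $d>0$ be a fixed integer. \begin{itemize} \item If $d$ is even, any deterministic distributed algorithm that guarantees a constant factor approximation for MaxDiCut on the class of $d$-regular bipartite $n$-vertex oriented graphs requires $\Omega(\log^* n)$ rounds in the LOCAL model. \item If $d$ is odd, then for any $\epsilon>0$, any deterministic $\left(\frac{2}{d}+\epsilon\right)$-approximation algorithm for MaxDiCut on the class of $d$-regular bipartite $n$-vertex oriented graphs requires $\Omega(\log^* n)$ rounds in the LOCAL model. \end{itemize}
   Context: An oriented graph is $d$-regular (resp. bipartite) if its underlying undirected graph is $d$-regular (resp. bipartite); out-degrees may be arbitrary. A directed cut is a bipartition $(A,B)$ of the vertex set; its size is the number of arcs with tail in $A$ and head in $B$. MaxDiCut asks for a directed cut of maximum size. A $\rho$-approximation algorithm always outputs a directed cut of size at least $\rho$ times the maximum; a constant factor approximation is a $\rho$-approximation for some fixed constant $\rho>0$. LOCAL model: each vertex of an $n$-vertex graph is a processor with unbounded computational power and a unique ID, an integer between $1$ and $\mathrm{poly}(n)$; in synchronous rounds each vertex sends messages of unbounded size to its neighbors, and at the end each vertex outputs its side ($0$ for $A$, $1$ for $B$). $\log^* n$ is $0$ if $n\le 1$ and $1+\log^*(\log_2 n)$ otherwise. -}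

module Defs where

open import Data.Nat as ℕ using (ℕ; zero; suc; _+_; _*_; _^_; _≤_; _≤ᵇ_; NonZero)
open import Data.Nat.Logarithm using (⌊log₂_⌋)
open import Data.Bool using (Bool; true; false; _∧_; _∨_; not; if_then_else_; T)
open import Data.Fin using (Fin)
import Data.Fin
open import Data.Product using (Σ; ∃; _×_; _,_)
open import Data.Sum using (_⊎_)
open import Data.Integer using (+_)
open import Data.Rational as ℚ using (ℚ)
open import Relation.Binary.PropositionalEquality using (_≡_; _≢_)
open import Relation.Nullary using (¬_)

countFin : (n : ℕ) → (Fin n → Bool) → ℕ
countFin zero    p = 0
countFin (suc n) p = (if p Data.Fin.zero then 1 else 0) + countFin n (λ i → p (Data.Fin.suc i))


sumFin : (n : ℕ) → (Fin n → ℕ) → ℕ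
sumFin zero    f = 0
sumFin (suc n) f = f Data.Fin.zero + sumFin n (λ i → f (Data.Fin.suc i))

record OGraph (n : ℕ) : Set where
  field
    arc     : Fin n → Fin n → Bool
    irrefl  : ∀ v → arc v v ≡ false
    antisym : ∀ u v → T (arc u v) → arc v u ≡ false
open OGraph public

adj : ∀ {n} → OGraph n → Fin n → Fin n → Bool
adj G u v = arc G u v ∨ arc G v u

degree : ∀ {n} → OGraph n → Fin n → ℕ
degree {n} G v = countFin n (λ u → adj G u v)

Regular : ∀ {n} → ℕ → OGraph n → Set
Regular d G = ∀ v → degree G v ≡ d

Bipartite : ∀ {n} → OGraph n → Set
Bipartite {n} G = Σ (Fin n → Bool) λ χ → ∀ u v → T (adj G u v) → χ u ≢ χ v

InClass : ∀ {n} → ℕ → OGraph n → Set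
InClass d G = Regular d G × Bipartite G

-- Directed cuts.  side v = false means v ∈ A, side v = true means v ∈ B.

Cut : ℕ → Set
Cut n = Fin n → Bool

cutSize : ∀ {n} → OGraph n → Cut n → ℕ
cutSize {n} G S = sumFin n λ u → countFin n λ v → arc G u v ∧ (not (S u) ∧ S v)

toℚ : ℕ → ℚ
toℚ m = (+ m) ℚ./ 1

IsApprox : ∀ {n} → ℚ → OGraph n → Cut n → Set
IsApprox {n} ρ G S = ∀ (S' : Cut n) → ρ ℚ.* toℚ (cutSize G S') ℚ.≤ toℚ (cutSize G S)

ValidIds : (k n : ℕ) → (Fin n → ℕ) → Set
ValidIds k n id = (∀ v → 1 ≤ id v × id v ≤ n ^ k) × (∀ u v → id u ≡ id v → u ≡ v)

data Within {n} (G : OGraph n) : ℕ → Fin n → Fin n → Set where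
  here : ∀ {r v} → Within G r v v
  step : ∀ {r v w u} → Within G r v w → T (adj G w u) → Within G (suc r) v u

-- Rooted isomorphism of the induced radius-r balls around v in (G,id) and
-- around v' in (G',id'), preserving identifiers and arc orientations.
SameView : ∀ {n} (r : ℕ) (G : OGraph n) (id : Fin n → ℕ) (v : Fin n)
                      (G' : OGraph n) (id' : Fin n → ℕ) (v' : Fin n) → Set
SameView {n} r G id v G' id' v' =
  Σ (Fin n → Fin n) λ f →
      (f v ≡ v')
    × (∀ u → Within G r v u → Within G' r v' (f u))
    × (∀ u' → Within G' r v' u' → Σ (Fin n) λ u → Within G r v u × f u ≡ u')
    × (∀ u → Within G r v u → id' (f u) ≡ id u)
    × (∀ u w → Within G r v u → Within G r v w → arc G' (f u) (f w) ≡ arc G u w)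

-- A deterministic r-round LOCAL algorithm on n-vertex graphs: the output of a
-- vertex depends only on its (ID- and orientation-labelled) radius-r view.
record LocalAlg (k n r : ℕ) : Set where
  field
    out      : OGraph n → (Fin n → ℕ) → Fin n → Bool
    locality : ∀ G id G' id' v v' → ValidIds k n id → ValidIds k n id' →
               SameView r G id v G' id' v' → out G id v ≡ out G' id' v'
open LocalAlg public

ApproxFamily : (d k : ℕ) → ℚ → (T : ℕ → ℕ) → ((n : ℕ) → LocalAlg k n (T n)) → Set
ApproxFamily d k ρ T A =
  ∀ n (G : OGraph n) (id : Fin n → ℕ) → InClass d G → ValidIds k n id →
    IsApprox ρ G (out (A n) G id)

-- log* (iterated binary logarithm), computed with fuel n ≥ log* n

logStarAux : ℕ → ℕ → ℕ
logStarAux zero    m = 0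
logStarAux (suc f) m = if m ≤ᵇ 1 then 0 else suc (logStarAux f ⌊log₂ m ⌋)

logStar : ℕ → ℕ
logStar n = logStarAux n n

-- T(n) = Ω(log* n), over those n for which the graph class is nonempty.
OmegaLogStar : (d : ℕ) → (ℕ → ℕ) → Set
OmegaLogStar d T =
  Σ ℕ λ C → Σ ℕ λ N → ∀ n → N ≤ n →
    (Σ (OGraph n) λ G → InClass d G) → logStar n ≤ C * T n

{-# OPTIONS --safe #-}
module Submission where

-- Let d = 2s + f with f ∈ {0, 1}.  On ℤ/P (P even) take the arcs p → p + δ for odd δ < 2s; two copies of
-- this circulant, joined by the matching (false, p) → (true, p) when f = 1, form a d-regular bipartite
-- graph whose rotation by one position exchanges the two sides.  In r rounds the output at a position
-- depends only on the identifiers in a window of 2R + 1 positions, R = 2sr.  By Linial's neighbourhood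
-- graph argument, any set of more than tower(O(r)) identifiers contains a sequence along which all windows
-- get the same output, so almost all positions can be filled with long runs of constant output.  Inside a
-- run only matching arcs are cut, hence the cut has at most fP arcs plus a small multiple of n, whereas one of the two
-- orientations of the bipartition cuts at least nd/4 arcs.  So n is at most a tower of height O(r).

open import Defs
open import Data.Nat using (ℕ; zero; suc; pred; _≤_; z≤n; s≤s; NonZero; >-nonZero; >-nonZero⁻¹)
open import Data.Nat.Properties
open import Data.Nat.Tactic.RingSolver using (solve-∀)
open import Data.Bool using (Bool; true; false; _∧_; _∨_; _xor_; not; if_then_else_; T)
open import Data.Product using (Σ; ∃; _×_; _,_; proj₁; proj₂)
open import Relation.Nullary using (Dec; yes; no; contradiction; ¬_)
open import Relation.Binary.PropositionalEquality using (_≡_; _≢_; refl; sym; trans; cong; cong₂; subst; subst₂; module ≡-Reasoning)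

-- The constant 2/d is the price of the matching. With n essentially 2P, an orientation of the
-- bipartition cuts about dP/2 arcs, while outputs that are constant along runs may still put one
-- track into A and the other into B and so cut all P matching arcs: a fraction 2f/d. For even d
-- this fraction is 0, so an arbitrary constant ρ plays the part of ε, and both cases are one
-- argument with f as a parameter. Two constraints shape the instance. The bipartition by parity of
-- the position survives the wrap-around only if P is even, but the bound is claimed for every large
-- n that admits a graph of the class; such n are even, and a junk component with at most 2(d+1)
-- vertices makes up the difference. Moreover the identifiers must form a valid assignment on the
-- whole graph, so one good sequence is not enough: blocks are carved one after another out of the
-- identifiers not yet placed, without disturbing the earlier blocks, until only about as many as
-- the tower remain.

module Construction where

  open import Data.Nat using (_+_; _*_; _∸_; _^_; _<_; _<ᵇ_; _≤ᵇ_; _≟_; _≤?_; _<?_)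
  open import Data.Nat.DivMod using (_%_; _/_; _mod_; m%n<n; m<n⇒m%n≡m; m≡m%n+[m/n]*n; %-distribˡ-+; m%n%n≡m%n; [m+kn]%n≡m%n; n%n≡0)
  open import Data.Nat.Logarithm using (⌊log₂_⌋; ⌊log₂⌋-mono-≤; ⌊log₂[2^n]⌋≡n)
  import Data.Bool as Bool
  open import Data.Bool.Properties using (∨-comm; ∨-identityʳ; ∧-zeroʳ; ∧-inverseˡ; xor-comm; not-involutive; not-injective; not-¬; ¬-not; T-≡; T-∧; T-∨)
  open import Data.Fin as Fin using (Fin; toℕ; fromℕ<; _↑ˡ_; _↑ʳ_; splitAt; join; combine; funToFin; finToFun)
  open import Data.Fin.Properties as Finₚ using (toℕ<n; toℕ-injective; toℕ-fromℕ<; toℕ-↑ˡ; toℕ-↑ʳ; splitAt-↑ˡ; splitAt-↑ʳ; join-splitAt; splitAt-join; pigeonhole; any?; combine-injective; finToFun-funToFin)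
  open import Data.Fin.Permutation using (Permutation; _⟨$⟩ʳ_; permutation)
  open import Data.List using (List; []; _∷_; length; drop; map)
  open import Data.List.Properties using (length-map; length-drop)
  open import Data.List.Relation.Unary.All as All using (All; []; _∷_)
  import Data.List.Relation.Unary.All.Properties as Allₚ
  open import Data.List.Relation.Unary.AllPairs as AllPairs using (AllPairs; []; _∷_)
  import Data.List.Relation.Unary.AllPairs.Properties as AllPairsₚ
  open import Data.Sum as Sum using (_⊎_; inj₁; inj₂)
  open import Data.Sum.Properties using (inj₁-injective; inj₂-injective)
  open import Data.Unit using (tt)
  open import Data.Empty using (⊥; ⊥-elim)
  open import Function using (_∘_; id; Equivalence)
  open import Relation.Nullary.Decidable using (_×-dec_)
  open import Algebra.Properties.CommutativeMonoid.Sum +-0-commutativeMonoid using (sum; ∑-comm; ∑-distrib-+; sum-permute)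

  -- Counting

  ind : Bool → ℕ
  ind b = if b then 1 else 0

  sumFin-cong : ∀ n {f g : Fin n → ℕ} → (∀ i → f i ≡ g i) → sumFin n f ≡ sumFin n g
  sumFin-cong zero    e = refl
  sumFin-cong (suc n) e = cong₂ _+_ (e Fin.zero) (sumFin-cong n (λ i → e (Fin.suc i)))

  sumFin-mono : ∀ n {f g : Fin n → ℕ} → (∀ i → f i ≤ g i) → sumFin n f ≤ sumFin n g
  sumFin-mono zero    e = z≤n
  sumFin-mono (suc n) e = +-mono-≤ (e Fin.zero) (sumFin-mono n (λ i → e (Fin.suc i)))

  sumFin≡sum : ∀ n (f : Fin n → ℕ) → sumFin n f ≡ sum f
  sumFin≡sum zero    f = refl
  sumFin≡sum (suc n) f = cong (f Fin.zero +_) (sumFin≡sum n _)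

  sumFin-+ : ∀ n (f g : Fin n → ℕ) → sumFin n (λ i → f i + g i) ≡ sumFin n f + sumFin n g
  sumFin-+ n f g = trans (sumFin≡sum n _) (trans (∑-distrib-+ f g) (sym (cong₂ _+_ (sumFin≡sum n f) (sumFin≡sum n g))))

  sumFin-comm : ∀ m n (f : Fin m → Fin n → ℕ) →
    sumFin m (λ i → sumFin n (f i)) ≡ sumFin n (λ j → sumFin m (λ i → f i j))
  sumFin-comm m n f = begin
    sumFin m (λ i → sumFin n (f i))         ≡⟨ sumFin-cong m (λ i → sumFin≡sum n (f i)) ⟩
    sumFin m (λ i → sum (f i))              ≡⟨ sumFin≡sum m _ ⟩
    sum (λ i → sum (f i))                   ≡⟨ ∑-comm f ⟩
    sum (λ j → sum (λ i → f i j))           ≡⟨ sym (sumFin≡sum n _) ⟩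
    sumFin n (λ j → sum (λ i → f i j))      ≡⟨ sumFin-cong n (λ j → sym (sumFin≡sum m _)) ⟩
    sumFin n (λ j → sumFin m (λ i → f i j)) ∎
    where open ≡-Reasoning

  sumFin-permute : ∀ n (f : Fin n → ℕ) (π : Permutation n n) → sumFin n f ≡ sumFin n (λ i → f (π ⟨$⟩ʳ i))
  sumFin-permute n f π = trans (sumFin≡sum n f) (trans (sum-permute f π) (sym (sumFin≡sum n _)))

  sumFin-const : ∀ n c → sumFin n (λ _ → c) ≡ n * c
  sumFin-const zero    c = refl
  sumFin-const (suc n) c = cong (c +_) (sumFin-const n c)

  sumFin-* : ∀ n c (f : Fin n → ℕ) → sumFin n (λ i → c * f i) ≡ c * sumFin n f
  sumFin-* zero    c f = sym (*-zeroʳ c)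
  sumFin-* (suc n) c f = trans (cong (c * f Fin.zero +_) (sumFin-* n c _)) (sym (*-distribˡ-+ c _ _))

  sumFin-↑ : ∀ a b (f : Fin (a + b) → ℕ) →
    sumFin (a + b) f ≡ sumFin a (λ i → f (i ↑ˡ b)) + sumFin b (λ i → f (a ↑ʳ i))
  sumFin-↑ zero    b f = refl
  sumFin-↑ (suc a) b f = trans (cong (f Fin.zero +_) (sumFin-↑ a b _)) (sym (+-assoc (f Fin.zero) _ _))

  countFin≡sumFin : ∀ n (p : Fin n → Bool) → countFin n p ≡ sumFin n (λ i → ind (p i))
  countFin≡sumFin zero    p = refl
  countFin≡sumFin (suc n) p = cong (ind (p Fin.zero) +_) (countFin≡sumFin n _)

  countFin-cong : ∀ n {p q : Fin n → Bool} → (∀ i → p i ≡ q i) → countFin n p ≡ countFin n q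
  countFin-cong zero    e = refl
  countFin-cong (suc n) e = cong₂ (λ b m → ind b + m) (e Fin.zero) (countFin-cong n (λ i → e (Fin.suc i)))

  countFin-↑ : ∀ a b (p : Fin (a + b) → Bool) →
    countFin (a + b) p ≡ countFin a (λ i → p (i ↑ˡ b)) + countFin b (λ i → p (a ↑ʳ i))
  countFin-↑ zero    b p = refl
  countFin-↑ (suc a) b p = trans (cong (ind (p Fin.zero) +_) (countFin-↑ a b _)) (sym (+-assoc (ind (p Fin.zero)) _ _))

  countFin-false : ∀ n {p : Fin n → Bool} → (∀ i → p i ≡ false) → countFin n p ≡ 0
  countFin-false zero    e = refl
  countFin-false (suc n) e rewrite e Fin.zero = countFin-false n (λ i → e (Fin.suc i))

  countFin-true : ∀ n → countFin n (λ _ → true) ≡ n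
  countFin-true zero    = refl
  countFin-true (suc n) = cong suc (countFin-true n)

  countFin-mono : ∀ n {p q : Fin n → Bool} → (∀ i → T (p i) → T (q i)) → countFin n p ≤ countFin n q
  countFin-mono zero    e = z≤n
  countFin-mono (suc n) {p} {q} e = +-mono-≤ (ind-mono (p Fin.zero) (q Fin.zero) (e Fin.zero)) (countFin-mono n (λ i → e (Fin.suc i)))
    where
    ind-mono : ∀ a b → (T a → T b) → ind a ≤ ind b
    ind-mono false b     h = z≤n
    ind-mono true  true  h = ≤-refl
    ind-mono true  false h = ⊥-elim (h tt)

  countFin-not : ∀ n (p : Fin n → Bool) → countFin n p + countFin n (λ i → not (p i)) ≡ n
  countFin-not n p = begin
    countFin n p + countFin n (λ i → not (p i))                        ≡⟨ cong₂ _+_ (countFin≡sumFin n p) (countFin≡sumFin n _) ⟩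
    sumFin n (λ i → ind (p i)) + sumFin n (λ i → ind (not (p i)))      ≡⟨ sym (sumFin-+ n _ _) ⟩
    sumFin n (λ i → ind (p i) + ind (not (p i)))                       ≡⟨ sumFin-cong n (λ i → one (p i)) ⟩
    sumFin n (λ _ → 1)                                                 ≡⟨ sumFin-const n 1 ⟩
    n * 1                                                              ≡⟨ *-identityʳ n ⟩
    n                                                                  ∎
    where
    open ≡-Reasoning
    one : ∀ b → ind b + ind (not b) ≡ 1
    one true  = refl
    one false = refl

  countFin-permute : ∀ n (p : Fin n → Bool) (π : Permutation n n) → countFin n p ≡ countFin n (λ i → p (π ⟨$⟩ʳ i))
  countFin-permute n p π = trans (countFin≡sumFin n p) (trans (sumFin-permute n _ π) (sym (countFin≡sumFin n _)))

  -- Arcs, degrees and bipartitions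

  arcs : ∀ {n} → OGraph n → ℕ
  arcs {n} G = sumFin n λ u → sumFin n λ v → ind (arc G u v)

  ind-adj : ∀ {n} (G : OGraph n) u v → ind (adj G u v) ≡ ind (arc G u v) + ind (arc G v u)
  ind-adj G u v with arc G u v in eq
  ... | false = refl
  ... | true rewrite antisym G u v (subst T (sym eq) tt) = refl

  handshake : ∀ {n d} (G : OGraph n) → Regular d G → n * d ≡ arcs G + arcs G
  handshake {n} {d} G reg = begin
    n * d                                                              ≡⟨ sym (sumFin-const n d) ⟩
    sumFin n (λ _ → d)                                                 ≡⟨ sumFin-cong n (λ v → sym (reg v)) ⟩
    sumFin n (λ v → degree G v)                                        ≡⟨ sumFin-cong n (λ v → deg v) ⟩
    sumFin n (λ v → sumFin n (λ u → ind (arc G u v)) + sumFin n (λ u → ind (arc G v u)))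
                                                                       ≡⟨ sumFin-+ n _ _ ⟩
    sumFin n (λ v → sumFin n (λ u → ind (arc G u v))) + arcs G         ≡⟨ cong (_+ arcs G) (sumFin-comm n n _) ⟩
    arcs G + arcs G                                                    ∎
    where
    open ≡-Reasoning
    deg : ∀ v → degree G v ≡ sumFin n (λ u → ind (arc G u v)) + sumFin n (λ u → ind (arc G v u))
    deg v = trans (countFin≡sumFin n _) (trans (sumFin-cong n (λ u → ind-adj G u v)) (sumFin-+ n _ _))

  arc⇒adj : ∀ {n} (G : OGraph n) u v → T (arc G u v) → T (adj G u v)
  arc⇒adj G u v t with arc G u v
  ... | true = tt

  -- Every arc of a bipartite graph is cut by exactly one of the two orientations of the bipartition.
  cut-bipartition : ∀ {n} (G : OGraph n) (χ : Fin n → Bool) → (∀ u v → T (adj G u v) → χ u ≢ χ v) →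
    cutSize G χ + cutSize G (λ v → not (χ v)) ≡ arcs G
  cut-bipartition {n} G χ bip = trans (sym (sumFin-+ n _ _)) (sumFin-cong n row)
    where
    open ≡-Reasoning
    cell : ∀ u v → ind (arc G u v ∧ (not (χ u) ∧ χ v)) + ind (arc G u v ∧ (not (not (χ u)) ∧ not (χ v))) ≡ ind (arc G u v)
    cell u v with arc G u v in eq
    ... | false = refl
    ... | true with χ u | χ v | bip u v (arc⇒adj G u v (subst T (sym eq) tt))
    ...   | true  | true  | ne = ⊥-elim (ne refl)
    ...   | true  | false | ne = refl
    ...   | false | true  | ne = refl
    ...   | false | false | ne = ⊥-elim (ne refl)
    row : ∀ u → countFin n (λ v → arc G u v ∧ (not (χ u) ∧ χ v)) + countFin n (λ v → arc G u v ∧ (not (not (χ u)) ∧ not (χ v)))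
              ≡ sumFin n (λ v → ind (arc G u v))
    row u = trans (cong₂ _+_ (countFin≡sumFin n _) (countFin≡sumFin n _))
                  (trans (sym (sumFin-+ n _ _)) (sumFin-cong n (cell u)))

  -- Both sides of the bipartition have the same size: d times each counts all the edges.
  class⇒even : ∀ {n d} .{{_ : NonZero d}} (G : OGraph n) → InClass d G → Σ ℕ λ m → n ≡ m + m
  class⇒even {n} {d} G (reg , χ , bip) = a , trans (sym (countFin-not n χ)) (cong (a +_) (sym a≡b))
    where
    open ≡-Reasoning
    a b : ℕ
    a = countFin n χ
    b = countFin n (λ v → not (χ v))
    side : ∀ (ψ : Fin n → Bool) → sumFin n (λ v → sumFin n (λ u → ind (ψ v) * ind (adj G u v))) ≡ d * countFin n ψ
    side ψ = begin
      sumFin n (λ v → sumFin n (λ u → ind (ψ v) * ind (adj G u v)))  ≡⟨ sumFin-cong n (λ v → sumFin-* n (ind (ψ v)) _) ⟩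
      sumFin n (λ v → ind (ψ v) * sumFin n (λ u → ind (adj G u v)))  ≡⟨ sumFin-cong n (λ v → cong (ind (ψ v) *_) (trans (sym (countFin≡sumFin n _)) (reg v))) ⟩
      sumFin n (λ v → ind (ψ v) * d)                                 ≡⟨ sumFin-cong n (λ v → *-comm (ind (ψ v)) d) ⟩
      sumFin n (λ v → d * ind (ψ v))                                 ≡⟨ sumFin-* n d _ ⟩
      d * sumFin n (λ v → ind (ψ v))                                 ≡⟨ cong (d *_) (sym (countFin≡sumFin n ψ)) ⟩
      d * countFin n ψ                                               ∎
    cell : ∀ u v → ind (χ v) * ind (adj G u v) ≡ ind (not (χ u)) * ind (adj G v u)
    cell u v rewrite ∨-comm (arc G v u) (arc G u v) with adj G u v in eq
    ... | false = trans (*-zeroʳ (ind (χ v))) (sym (*-zeroʳ (ind (not (χ u)))))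
    ... | true with χ u | χ v | bip u v (subst T (sym eq) tt)
    ...   | true  | true  | ne = ⊥-elim (ne refl)
    ...   | true  | false | ne = refl
    ...   | false | true  | ne = refl
    ...   | false | false | ne = ⊥-elim (ne refl)
    a≡b : a ≡ b
    a≡b = *-cancelˡ-≡ a b d (begin
      d * a                                                                ≡⟨ sym (side χ) ⟩
      sumFin n (λ v → sumFin n (λ u → ind (χ v) * ind (adj G u v)))        ≡⟨ sumFin-cong n (λ v → sumFin-cong n (λ u → cell u v)) ⟩
      sumFin n (λ v → sumFin n (λ u → ind (not (χ u)) * ind (adj G v u)))  ≡⟨ sumFin-comm n n _ ⟩
      sumFin n (λ u → sumFin n (λ v → ind (not (χ u)) * ind (adj G v u)))  ≡⟨ side (λ v → not (χ v)) ⟩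
      d * b                                                                ∎)

  -- Towers and monochromatic shifts

  -- A tower of j twos topped by c. The exponential is put at the top, so that replacing c colours
  -- by 2^c colours in the shift argument lowers j by one definitionally; `tw-suc` gives the other
  -- unfolding, needed for taking logarithms.
  tw : ℕ → ℕ → ℕ
  tw zero    c = c
  tw (suc j) c = tw j (2 ^ c)

  tw-suc : ∀ j c → tw (suc j) c ≡ 2 ^ tw j c
  tw-suc zero    c = refl
  tw-suc (suc j) c = tw-suc j (2 ^ c)

  n<2^n : ∀ n → n < 2 ^ n
  n<2^n zero    = s≤s z≤n
  n<2^n (suc n) = begin-strict
    suc n          ≤⟨ n<2^n n ⟩
    2 ^ n          <⟨ m<m+n (2 ^ n) (m^n>0 2 n) ⟩
    2 ^ n + 2 ^ n  ≡⟨ cong (2 ^ n +_) (sym (+-identityʳ _)) ⟩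
    2 ^ suc n      ∎
    where open ≤-Reasoning

  tw-+ : ∀ j c x → tw j c + x ≤ tw j (c + x)
  tw-+ zero    c x = ≤-refl
  tw-+ (suc j) c x rewrite tw-suc j c | tw-suc j (c + x) = begin
    2 ^ t + x          ≤⟨ +-monoʳ-≤ (2 ^ t) (m≤n*m x (2 ^ t) {{m^n≢0 2 t}}) ⟩
    2 ^ t + 2 ^ t * x  ≡⟨ sym (*-suc (2 ^ t) x) ⟩
    2 ^ t * suc x      ≤⟨ *-monoʳ-≤ (2 ^ t) (n<2^n x) ⟩
    2 ^ t * 2 ^ x      ≡⟨ sym (^-distribˡ-+-* 2 t x) ⟩
    2 ^ (t + x)        ≤⟨ ^-monoʳ-≤ 2 (tw-+ j c x) ⟩
    2 ^ tw j (c + x)   ∎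
    where
    open ≤-Reasoning
    t = tw j c

  -- As z ≤ 2^z, a factor in front of at least one exponential is an added exponent, and `tw-+`
  -- pushes additions up to c. A constant factor thus costs only a constant in log*.
  *-tw : ∀ j c z → z * tw (suc j) c ≤ tw (suc j) (c + z)
  *-tw j c z rewrite tw-suc j c | tw-suc j (c + z) = begin
    z * 2 ^ t        ≡⟨ *-comm z (2 ^ t) ⟩
    2 ^ t * z        ≤⟨ *-monoʳ-≤ (2 ^ t) (<⇒≤ (n<2^n z)) ⟩
    2 ^ t * 2 ^ z    ≡⟨ sym (^-distribˡ-+-* 2 t z) ⟩
    2 ^ (t + z)      ≤⟨ ^-monoʳ-≤ 2 (tw-+ j c z) ⟩
    2 ^ tw j (c + z) ∎
    where
    open ≤-Reasoning
    t = tw j c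

  ⌊log₂⌋-≤ : ∀ {m t} → m ≤ 2 ^ t → ⌊log₂ m ⌋ ≤ t
  ⌊log₂⌋-≤ {m} {t} p = subst (⌊log₂ m ⌋ ≤_) (⌊log₂[2^n]⌋≡n t) (⌊log₂⌋-mono-≤ p)

  logStarAux-≤ : ∀ f m → logStarAux f m ≤ m
  logStarAux-≤ zero    m = z≤n
  logStarAux-≤ (suc f) zero = z≤n
  logStarAux-≤ (suc f) (suc zero) = z≤n
  logStarAux-≤ (suc f) (suc (suc m)) =
    s≤s (≤-trans (logStarAux-≤ f _) (⌊log₂⌋-≤ {suc (suc m)} {suc m} (n<2^n (suc m))))

  -- Each logarithm strips one level of the tower, and what is left at the end contributes at most
  -- its own value b. Running out of fuel only makes the left side smaller, so `f` is arbitrary.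
  logStarAux-tw : ∀ f h {b m} → m ≤ tw h b → logStarAux f m ≤ h + b
  logStarAux-tw f       zero    p = ≤-trans (logStarAux-≤ f _) p
  logStarAux-tw zero    (suc h) p = z≤n
  logStarAux-tw (suc f) (suc h) {b} {m} p with m ≤ᵇ 1
  ... | true  = z≤n
  ... | false = s≤s (logStarAux-tw f h (⌊log₂⌋-≤ {m} (≤-trans p (≤-reflexive (tw-suc h b)))))

  front : ∀ {A : Set} → List A → List A
  front []           = []
  front (x ∷ [])     = []
  front (x ∷ y ∷ ys) = x ∷ front (y ∷ ys)

  -- Linial's argument: from a colouring g of (j+1)-tuples one passes to the
  -- colouring of j-tuples v by the set of colours g (y ∷ v), y < v.
  shift-monochromatic : ∀ j {c M} (g : List (Fin M) → Fin c) → tw j c < M →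
    ∃ λ xs → length xs ≡ suc (suc j) × AllPairs Fin._<_ xs × g (front xs) ≡ g (drop 1 xs)
  shift-monochromatic zero g lt with pigeonhole lt (λ i → g (i ∷ []))
  ... | i , j , i<j , e = i ∷ j ∷ [] , refl , (i<j ∷ []) ∷ [] ∷ [] , e
  shift-monochromatic (suc j) {c} {M} g lt = extend (shift-monochromatic j h lt)
    where
    Occurs : List (Fin M) → Fin c → Set
    Occurs v k = ∃ λ y → All (y Fin.<_) v × g (y ∷ v) ≡ k
    occurs? : ∀ v k → Dec (Occurs v k)
    occurs? v k = any? (λ y → All.all? (y Finₚ.<?_) v ×-dec (g (y ∷ v) Finₚ.≟ k))
    bit : ∀ {A : Set} → Dec A → Fin 2
    bit (yes _) = Fin.suc Fin.zero
    bit (no  _) = Fin.zero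
    bit-yes : ∀ {A B : Set} (a : Dec A) (b : Dec B) → bit a ≡ bit b → B → A
    bit-yes (yes a) _       e y = a
    bit-yes (no _)  (no ¬b) e y = contradiction y ¬b
    palette : List (Fin M) → Fin c → Fin 2
    palette v k = bit (occurs? v k)
    h : List (Fin M) → Fin (2 ^ c)
    h v = funToFin (palette v)
    extend : (∃ λ xs → length xs ≡ suc (suc j) × AllPairs Fin._<_ xs × h (front xs) ≡ h (drop 1 xs)) →
      ∃ λ xs → length xs ≡ suc (suc (suc j)) × AllPairs Fin._<_ xs × g (front xs) ≡ g (drop 1 xs)
    -- The colour `k` of `vs` occurs in the palette of the tail of `vs`, with `x` as witness. The
    -- palette of `front vs` is the same, so some `y` below all of `front vs` gives `y ∷ front vs`
    -- the colour `k` too, and `y ∷ vs` is the longer sequence.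
    extend (x ∷ x′ ∷ xs , len , asc@(x< ∷ _) , e) = result (bit-yes (occurs? (front vs) k) (occurs? (x′ ∷ xs) k) same (x , x< , refl))
      where
      vs = x ∷ x′ ∷ xs
      k = g vs
      same : palette (front vs) k ≡ palette (x′ ∷ xs) k
      same = trans (sym (finToFun-funToFin (palette (front vs)) k))
                   (trans (cong (λ z → finToFun z k) e) (finToFun-funToFin (palette (x′ ∷ xs)) k))
      result : Occurs (front vs) k →
        ∃ λ xs → length xs ≡ suc (suc (suc j)) × AllPairs Fin._<_ xs × g (front xs) ≡ g (drop 1 xs)
      result (y , y<x ∷ _ , e′) = y ∷ vs , cong suc len , ((y<x ∷ All.map (Finₚ.<-trans y<x) x<) ∷ asc) , e′

  -- Block graphs, circulants and their rotations

  ↑-elim : ∀ a {b} (P : Fin (a + b) → Set) → (∀ i → P (i ↑ˡ b)) → (∀ j → P (a ↑ʳ j)) → ∀ u → P u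
  ↑-elim a {b} P l r u = subst P (join-splitAt a b u) (go (splitAt a u))
    where
    go : ∀ x → P (join a b x)
    go (inj₁ i) = l i
    go (inj₂ j) = r j

  -- One construction for three uses: two circulants joined by a matching, a disjoint union with the
  -- junk (`X` constantly false), and bipartite graphs given by a biadjacency matrix (`A` and `D`
  -- without arcs).
  module Block {a b} (A : OGraph a) (X : Fin a → Fin b → Bool) (D : OGraph b) where

    blockArc : Fin a ⊎ Fin b → Fin a ⊎ Fin b → Bool
    blockArc (inj₁ i) (inj₁ i′) = arc A i i′
    blockArc (inj₁ i) (inj₂ j)  = X i j
    blockArc (inj₂ j) (inj₁ i)  = false
    blockArc (inj₂ j) (inj₂ j′) = arc D j j′

    block : OGraph (a + b)
    block = record
      { arc     = λ u v → blockArc (splitAt a u) (splitAt a v)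
      ; irrefl  = λ v → irr (splitAt a v)
      ; antisym = λ u v → anti (splitAt a u) (splitAt a v)
      }
      where
      irr : ∀ x → blockArc x x ≡ false
      irr (inj₁ i) = irrefl A i
      irr (inj₂ j) = irrefl D j
      anti : ∀ x y → T (blockArc x y) → blockArc y x ≡ false
      anti (inj₁ i) (inj₁ i′) t = antisym A i i′ t
      anti (inj₁ i) (inj₂ j)  t = refl
      anti (inj₂ j) (inj₂ j′) t = antisym D j j′ t

    arc-ll : ∀ i i′ → arc block (i ↑ˡ b) (i′ ↑ˡ b) ≡ arc A i i′
    arc-ll i i′ rewrite splitAt-↑ˡ a i b | splitAt-↑ˡ a i′ b = refl

    arc-lr : ∀ i j → arc block (i ↑ˡ b) (a ↑ʳ j) ≡ X i j
    arc-lr i j rewrite splitAt-↑ˡ a i b | splitAt-↑ʳ a b j = refl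

    arc-rl : ∀ i j → arc block (a ↑ʳ j) (i ↑ˡ b) ≡ false
    arc-rl i j rewrite splitAt-↑ˡ a i b | splitAt-↑ʳ a b j = refl

    arc-rr : ∀ j j′ → arc block (a ↑ʳ j) (a ↑ʳ j′) ≡ arc D j j′
    arc-rr j j′ rewrite splitAt-↑ʳ a b j | splitAt-↑ʳ a b j′ = refl

    adj-ll : ∀ i i′ → adj block (i ↑ˡ b) (i′ ↑ˡ b) ≡ adj A i i′
    adj-ll i i′ = cong₂ _∨_ (arc-ll i i′) (arc-ll i′ i)

    adj-lr : ∀ i j → adj block (i ↑ˡ b) (a ↑ʳ j) ≡ X i j
    adj-lr i j = trans (cong₂ _∨_ (arc-lr i j) (arc-rl i j)) (∨-identityʳ _)

    adj-rl : ∀ i j → adj block (a ↑ʳ j) (i ↑ˡ b) ≡ X i j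
    adj-rl i j = cong₂ _∨_ (arc-rl i j) (arc-lr i j)

    adj-rr : ∀ j j′ → adj block (a ↑ʳ j) (a ↑ʳ j′) ≡ adj D j j′
    adj-rr j j′ = cong₂ _∨_ (arc-rr j j′) (arc-rr j′ j)

    block-regular : ∀ {d} → (∀ i → degree A i + countFin b (X i) ≡ d) →
      (∀ j → countFin a (λ i → X i j) + degree D j ≡ d) → Regular d block
    block-regular l r = ↑-elim a _
      (λ i → trans (countFin-↑ a b _) (trans (cong₂ _+_ (countFin-cong a (λ u → adj-ll u i)) (countFin-cong b (λ u → adj-rl i u))) (l i)))
      (λ j → trans (countFin-↑ a b _) (trans (cong₂ _+_ (countFin-cong a (λ u → adj-lr u j)) (countFin-cong b (λ u → adj-rr u j))) (r j)))

    block-bipartite : (bA : Bipartite A) (bD : Bipartite D) →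
      (∀ i j → T (X i j) → proj₁ bA i ≢ proj₁ bD j) → Bipartite block
    block-bipartite (χ , hχ) (ψ , hψ) hX = (λ v → col (splitAt a v)) , λ u v → go (splitAt a u) (splitAt a v)
      where
      col : Fin a ⊎ Fin b → Bool
      col (inj₁ i) = χ i
      col (inj₂ j) = ψ j
      go : ∀ x y → T (blockArc x y ∨ blockArc y x) → col x ≢ col y
      go (inj₁ i) (inj₁ i′) t = hχ i i′ t
      go (inj₁ i) (inj₂ j)  t = hX i j (subst T (∨-identityʳ _) t)
      go (inj₂ j) (inj₁ i)  t = hX i j t ∘ sym
      go (inj₂ j) (inj₂ j′) t = hψ j j′ t

  open Block using (block; block-regular; block-bipartite) public

  noArcs : ∀ n → OGraph n
  noArcs n = record { arc = λ _ _ → false ; irrefl = λ _ → refl ; antisym = λ _ _ () }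

  noArcs-bipartite : ∀ n → Bool → Bipartite (noArcs n)
  noArcs-bipartite n c = (λ _ → c) , λ _ _ ()

  noArcs-degree : ∀ n v → degree (noArcs n) v ≡ 0
  noArcs-degree n v = countFin-false n (λ _ → refl)

  biregular⇒class : ∀ {d j} (X : Fin j → Fin j → Bool) → (∀ i → countFin j (X i) ≡ d) →
    (∀ i → countFin j (λ i′ → X i′ i) ≡ d) → Σ (OGraph (j + j)) (InClass d)
  biregular⇒class {d} {j} X rows cols = block (noArcs j) X (noArcs j)
    , block-regular _ _ _ (λ i → cong₂ _+_ (noArcs-degree j i) (rows i))
                    (λ i → trans (cong₂ _+_ (cols i) (noArcs-degree j i)) (+-identityʳ d))
    , block-bipartite _ _ _ (noArcs-bipartite j false) (noArcs-bipartite j true) (λ _ _ _ ())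

  eqᵇ : ∀ {n} → Fin n → Fin n → Bool
  eqᵇ Fin.zero    Fin.zero    = true
  eqᵇ Fin.zero    (Fin.suc j) = false
  eqᵇ (Fin.suc i) Fin.zero    = false
  eqᵇ (Fin.suc i) (Fin.suc j) = eqᵇ i j

  eqᵇ-sym : ∀ {n} (i j : Fin n) → eqᵇ i j ≡ eqᵇ j i
  eqᵇ-sym Fin.zero    Fin.zero    = refl
  eqᵇ-sym Fin.zero    (Fin.suc j) = refl
  eqᵇ-sym (Fin.suc i) Fin.zero    = refl
  eqᵇ-sym (Fin.suc i) (Fin.suc j) = eqᵇ-sym i j

  eqᵇ⇒≡ : ∀ {n} (i j : Fin n) → T (eqᵇ i j) → i ≡ j
  eqᵇ⇒≡ Fin.zero    Fin.zero    t = refl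
  eqᵇ⇒≡ (Fin.suc i) (Fin.suc j) t = cong Fin.suc (eqᵇ⇒≡ i j t)

  eqᵇ-refl : ∀ {n} (i : Fin n) → eqᵇ i i ≡ true
  eqᵇ-refl Fin.zero    = refl
  eqᵇ-refl (Fin.suc i) = eqᵇ-refl i

  eqᵇ-injective : ∀ {m n} (f : Fin m → Fin n) → (∀ i j → f i ≡ f j → i ≡ j) → ∀ i j → eqᵇ (f i) (f j) ≡ eqᵇ i j
  eqᵇ-injective f inj i j with eqᵇ (f i) (f j) in e | eqᵇ i j in e′
  ... | true  | true  = refl
  ... | false | false = refl
  ... | true  | false = contradiction (trans (sym e′) (trans (cong (eqᵇ i) (sym (inj i j (eqᵇ⇒≡ _ _ (subst T (sym e) tt))))) (eqᵇ-refl i))) λ ()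
  ... | false | true  = contradiction (trans (sym e) (trans (cong (λ k → eqᵇ (f i) (f k)) (sym (eqᵇ⇒≡ i j (subst T (sym e′) tt)))) (eqᵇ-refl (f i)))) λ ()

  countFin-eqᵇ : ∀ n (i : Fin n) → countFin n (eqᵇ i) ≡ 1
  countFin-eqᵇ (suc n) Fin.zero    = cong suc (countFin-false n (λ _ → refl))
  countFin-eqᵇ (suc n) (Fin.suc i) = countFin-eqᵇ n i

  -- This graph and `crown`, which is the complete bipartite graph on d+1 and d+1 vertices minus a
  -- perfect matching, serve as junk. Their sides have d and d+1 vertices, so one of them has
  -- whichever parity is wanted.
  completeBipartite : ∀ d → Σ (OGraph (d + d)) (InClass d)
  completeBipartite d = biregular⇒class {j = d} (λ _ _ → true) (λ _ → countFin-true d) (λ _ → countFin-true d)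

  crown : ∀ d → Σ (OGraph (suc d + suc d)) (InClass d)
  crown d = biregular⇒class (λ i j → not (eqᵇ i j)) row (λ i → trans (countFin-cong (suc d) (λ j → cong not (eqᵇ-sym j i))) (row i))
    where
    row : ∀ i → countFin (suc d) (λ j → not (eqᵇ i j)) ≡ d
    row i = suc-injective (trans (cong (_+ countFin (suc d) (λ j → not (eqᵇ i j))) (sym (countFin-eqᵇ (suc d) i))) (countFin-not (suc d) (eqᵇ i)))

  joinMap : ∀ {a b} → (Fin a → Fin a) → (Fin b → Fin b) → Fin (a + b) → Fin (a + b)
  joinMap {a} {b} f g u = join a b (Sum.map f g (splitAt a u))

  joinMap-↑ˡ : ∀ {a b} (f : Fin a → Fin a) (g : Fin b → Fin b) i → joinMap f g (i ↑ˡ b) ≡ f i ↑ˡ b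
  joinMap-↑ˡ {a} {b} f g i rewrite splitAt-↑ˡ a i b = refl

  joinMap-↑ʳ : ∀ {a b} (f : Fin a → Fin a) (g : Fin b → Fin b) j → joinMap f g (a ↑ʳ j) ≡ a ↑ʳ g j
  joinMap-↑ʳ {a} {b} f g j rewrite splitAt-↑ʳ a b j = refl

  joinMap-id : ∀ {a b} {f : Fin a → Fin a} {g : Fin b → Fin b} → (∀ i → f i ≡ i) → (∀ j → g j ≡ j) → ∀ u → joinMap f g u ≡ u
  joinMap-id {a} {b} {f} {g} hf hg = ↑-elim a _
    (λ i → trans (joinMap-↑ˡ f g i) (cong (_↑ˡ b) (hf i)))
    (λ j → trans (joinMap-↑ʳ f g j) (cong (a ↑ʳ_) (hg j)))

  joinMap-injective : ∀ {a b} {f : Fin a → Fin a} {g : Fin b → Fin b} → (∀ i j → f i ≡ f j → i ≡ j) →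
    (∀ i j → g i ≡ g j → i ≡ j) → ∀ u v → joinMap f g u ≡ joinMap f g v → u ≡ v
  joinMap-injective {a} {b} {f} {g} hf hg u v e = begin
    u                        ≡⟨ sym (join-splitAt a b u) ⟩
    join a b (splitAt a u)   ≡⟨ cong (join a b) (go (splitAt a u) (splitAt a v) e′) ⟩
    join a b (splitAt a v)   ≡⟨ join-splitAt a b v ⟩
    v                        ∎
    where
    open ≡-Reasoning
    e′ : Sum.map f g (splitAt a u) ≡ Sum.map f g (splitAt a v)
    e′ = trans (sym (Finₚ.splitAt-join a b _)) (trans (cong (splitAt a) e) (Finₚ.splitAt-join a b _))
    go : ∀ x y → Sum.map f g x ≡ Sum.map f g y → x ≡ y
    go (inj₁ i) (inj₁ j) q = cong inj₁ (hf i j (inj₁-injective q))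
    go (inj₂ i) (inj₂ j) q = cong inj₂ (hg i j (inj₂-injective q))

  IsAut : ∀ {n} → OGraph n → (Fin n → Fin n) → Set
  IsAut G f = ∀ u v → arc G (f u) (f v) ≡ arc G u v

  block-aut : ∀ {a b} (A : OGraph a) (X : Fin a → Fin b → Bool) (D : OGraph b) {f g} →
    IsAut A f → (∀ i j → X (f i) (g j) ≡ X i j) → IsAut D g → IsAut (block A X D) (joinMap f g)
  block-aut {a} {b} A X D {f} {g} hf hX hg u v
    rewrite Finₚ.splitAt-join a b (Sum.map f g (splitAt a u)) | Finₚ.splitAt-join a b (Sum.map f g (splitAt a v))
    with splitAt a u | splitAt a v
  ... | inj₁ i | inj₁ i′ = hf i i′
  ... | inj₁ i | inj₂ j  = hX i j
  ... | inj₂ j | inj₁ i  = refl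
  ... | inj₂ j | inj₂ j′ = hg j j′

  -- Parity, cyclic distance and the circulant of odd jumps

  m+m≡m*2 : ∀ m → m + m ≡ m * 2
  m+m≡m*2 m = trans (cong (m +_) (sym (+-identityʳ m))) (*-comm 2 m)

  odd : ℕ → Bool
  odd zero    = false
  odd (suc n) = not (odd n)

  odd-+ : ∀ m n → odd (m + n) ≡ odd m xor odd n
  odd-+ zero    n = refl
  odd-+ (suc m) n = trans (cong not (odd-+ m n)) (not-xor (odd m) (odd n))
    where
    not-xor : ∀ x y → not (x xor y) ≡ not x xor y
    not-xor true  y = not-involutive y
    not-xor false y = refl

  odd-*2 : ∀ s → odd (s * 2) ≡ false
  odd-*2 zero    = refl
  odd-*2 (suc s) = trans (not-involutive _) (odd-*2 s)

  odd-∸ : ∀ {m n} → m ≤ n → odd n ≡ false → odd (n ∸ m) ≡ odd m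
  odd-∸ {m} {n} m≤n e = xor-false (odd (n ∸ m)) (odd m) (trans (sym (odd-+ (n ∸ m) m)) (trans (cong odd (m∸n+n≡m m≤n)) e))
    where
    xor-false : ∀ x y → x xor y ≡ false → x ≡ y
    xor-false true  true  _ = refl
    xor-false false false _ = refl

  isJump : ℕ → ℕ → Bool
  isJump D δ = odd δ ∧ (δ <ᵇ D)

  isJump⇒odd : ∀ D δ → T (isJump D δ) → odd δ ≡ true
  isJump⇒odd D δ t with odd δ
  ... | true = refl

  isJump⇒< : ∀ D δ → T (isJump D δ) → δ < D
  isJump⇒< D δ t with odd δ
  ... | true = <ᵇ⇒< δ D t

  ¬<⇒¬isJump : ∀ D δ → D ≤ δ → isJump D δ ≡ false
  ¬<⇒¬isJump D δ D≤δ with isJump D δ in e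
  ... | false = refl
  ... | true  = contradiction (isJump⇒< D δ (subst T (sym e) tt)) (≤⇒≯ D≤δ)

  module Cycle (P : ℕ) .{{_ : NonZero P}} where

    dist : ℕ → ℕ → ℕ
    dist p p′ with p ≤? p′
    ... | yes _ = p′ ∸ p
    ... | no  _ = (P + p′) ∸ p

    -- The two ways in which δ steps from p can end at p′: without or with one passage through 0.
    -- Congruences modulo P become linear equations in ℕ, which by `spec-unique` determine δ below
    -- P.
    Spec : ℕ → ℕ → ℕ → Set
    Spec p p′ δ = p + δ ≡ p′ ⊎ p + δ ≡ P + p′

    dist-spec : ∀ {p} p′ → p < P → Spec p p′ (dist p p′)
    dist-spec {p} p′ p<P with p ≤? p′
    ... | yes p≤p′ = inj₁ (m+[n∸m]≡n p≤p′)
    ... | no  _    = inj₂ (m+[n∸m]≡n (≤-trans (<⇒≤ p<P) (m≤m+n P p′)))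

    dist<P : ∀ {p p′} → p < P → p′ < P → dist p p′ < P
    dist<P {p} {p′} p<P p′<P with p ≤? p′
    ... | yes p≤p′ = ≤-<-trans (m∸n≤m p′ p) p′<P
    ... | no  p≰p′ = +-cancelˡ-< p _ _ (begin-strict
      p + ((P + p′) ∸ p) ≡⟨ m+[n∸m]≡n (≤-trans (<⇒≤ p<P) (m≤m+n P p′)) ⟩
      P + p′             <⟨ +-monoʳ-< P (≰⇒> p≰p′) ⟩
      P + p              ≡⟨ +-comm P p ⟩
      p + P              ∎)
      where open ≤-Reasoning

    dist-self : ∀ p → dist p p ≡ 0
    dist-self p with p ≤? p
    ... | yes _  = n∸n≡0 p
    ... | no p≰p = contradiction ≤-refl p≰p

    spec-unique : ∀ {p p′ δ δ′} → δ < P → δ′ < P → Spec p p′ δ → Spec p p′ δ′ → δ ≡ δ′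
    spec-unique {p} δ<P δ′<P (inj₁ e) (inj₁ e′) = +-cancelˡ-≡ p _ _ (trans e (sym e′))
    spec-unique {p} δ<P δ′<P (inj₂ e) (inj₂ e′) = +-cancelˡ-≡ p _ _ (trans e (sym e′))
    spec-unique {p} {p′} {δ} {δ′} δ<P δ′<P (inj₁ e) (inj₂ e′) = contradiction δ′<P (≤⇒≯ (wrap e e′))
      where
      wrap : ∀ {δ δ′} → p + δ ≡ p′ → p + δ′ ≡ P + p′ → P ≤ δ′
      wrap {δ} {δ′} e e′ = +-cancelˡ-≤ p _ _ (begin
        p + P         ≡⟨ +-comm p P ⟩
        P + p         ≤⟨ +-monoʳ-≤ P (≤-trans (m≤m+n p δ) (≤-reflexive e)) ⟩
        P + p′        ≡⟨ sym e′ ⟩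
        p + δ′        ∎)
        where open ≤-Reasoning
    spec-unique {p} {p′} {δ} {δ′} δ<P δ′<P (inj₂ e) (inj₁ e′) = sym (spec-unique {p} {p′} {δ′} {δ} δ′<P δ<P (inj₁ e′) (inj₂ e))

    suc%-cases : ∀ {p} → p < P → (suc p % P ≡ suc p) ⊎ (suc p ≡ P × suc p % P ≡ 0)
    suc%-cases {p} p<P with suc p <? P
    ... | yes sp<P = inj₁ (m<n⇒m%n≡m sp<P)
    ... | no  sp≮P = inj₂ (eq , trans (cong (_% P) eq) (n%n≡0 P))
      where eq = ≤-antisym p<P (≮⇒≥ sp≮P)

    -- The cases are which of p and p′ is the last position P - 1. If exactly one of them is, then
    -- the jump changes between wrapping and not wrapping; the combinations that cannot occur
    -- contradict the order of p and p′ or δ < P.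
    spec-suc : ∀ {p p′ δ} → p < P → p′ < P → δ < P → Spec p p′ δ → Spec (suc p % P) (suc p′ % P) δ
    spec-suc {p} {p′} {δ} p<P p′<P δ<P sp with suc%-cases p<P | suc%-cases p′<P
    spec-suc p<P p′<P δ<P (inj₁ e) | inj₁ q | inj₁ q′ rewrite q | q′ = inj₁ (cong suc e)
    spec-suc {p} {p′} p<P p′<P δ<P (inj₂ e) | inj₁ q | inj₁ q′ rewrite q | q′ = inj₂ (trans (cong suc e) (sym (+-suc P p′)))
    spec-suc {p} {p′} {δ} p<P p′<P δ<P (inj₁ e) | inj₂ (w , q) | inj₁ q′ rewrite q | q′ =
      contradiction (≤-trans (s≤s (s≤s (≤-trans (m≤m+n p δ) (≤-reflexive e)))) (≤-trans (≤∧≢⇒< p′<P ne) (≤-reflexive (sym w)))) (<-irrefl refl)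
      where
      ne : suc p′ ≢ P
      ne eq = 1+n≢0 (trans (sym q′) (trans (cong (_% P) eq) (n%n≡0 P)))
    spec-suc {p} {p′} {δ} p<P p′<P δ<P (inj₂ e) | inj₂ (w , q) | inj₁ q′ rewrite q | q′ =
      inj₁ (+-cancelˡ-≡ p _ _ (trans e (trans (cong (_+ p′) (sym w)) (sym (+-suc p p′)))))
    spec-suc {p} {p′} {δ} p<P p′<P δ<P (inj₁ e) | inj₁ q | inj₂ (w , q′) rewrite q | q′ =
      inj₂ (trans (cong suc e) (trans w (sym (+-identityʳ P))))
    spec-suc {p} {p′} {δ} p<P p′<P δ<P (inj₂ e) | inj₁ q | inj₂ (w , q′) =
      contradiction (begin-strict
        P + p′        ≡⟨ sym e ⟩
        p + δ         <⟨ +-mono-≤-< (≤-pred (≤-trans p<P (≤-reflexive (sym w)))) δ<P ⟩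
        p′ + P        ≡⟨ +-comm p′ P ⟩
        P + p′        ∎) (<-irrefl refl)
      where open ≤-Reasoning
    spec-suc {p} {p′} {δ} p<P p′<P δ<P sp | inj₂ (w , q) | inj₂ (w′ , q′) rewrite q | q′ with suc-injective (trans w (sym w′))
    ... | refl with sp
    ...   | inj₁ e = inj₁ (+-cancelˡ-≡ p _ _ (trans e (sym (+-identityʳ p))))
    ...   | inj₂ e = contradiction δ<P (≤⇒≯ (≤-reflexive (+-cancelˡ-≡ p _ _ (trans (+-comm p P) (sym e)))))

    dist-suc : ∀ {p p′} → p < P → p′ < P → dist (suc p % P) (suc p′ % P) ≡ dist p p′
    dist-suc {p} {p′} p<P p′<P = spec-unique (dist<P n<P n′<P) (dist<P p<P p′<P) (dist-spec _ n<P)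
      (spec-suc p<P p′<P (dist<P p<P p′<P) (dist-spec p′ p<P))
      where
      n<P = m%n<n (suc p) P
      n′<P = m%n<n (suc p′) P

    rot : ℕ → Fin P → Fin P
    rot t p = (t + toℕ p) mod P

    toℕ-mod : ∀ m → toℕ (m mod P) ≡ m % P
    toℕ-mod m = toℕ-fromℕ< (m%n<n m P)

    mod-cong : ∀ {m m′} → m % P ≡ m′ % P → m mod P ≡ m′ mod P
    mod-cong {m} {m′} e = toℕ-injective (trans (toℕ-mod m) (trans e (sym (toℕ-mod m′))))

    toℕ-mod-id : ∀ p → toℕ p mod P ≡ p
    toℕ-mod-id p = toℕ-injective (trans (toℕ-mod _) (m<n⇒m%n≡m (toℕ<n p)))

    rot-mod : ∀ t m → rot t (m mod P) ≡ (t + m) mod P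
    rot-mod t m = mod-cong (begin
      (t + toℕ (m mod P)) % P       ≡⟨ cong (λ x → (t + x) % P) (toℕ-mod m) ⟩
      (t + m % P) % P               ≡⟨ %-distribˡ-+ t (m % P) P ⟩
      (t % P + m % P % P) % P       ≡⟨ cong (λ x → (t % P + x) % P) (m%n%n≡m%n m P) ⟩
      (t % P + m % P) % P           ≡⟨ sym (%-distribˡ-+ t m P) ⟩
      (t + m) % P                   ∎)
      where open ≡-Reasoning

    rot-rot : ∀ t t′ p → rot t (rot t′ p) ≡ rot (t + t′) p
    rot-rot t t′ p = trans (rot-mod t _) (cong (_mod P) (sym (+-assoc t t′ (toℕ p))))

    rot-period : ∀ k p → rot (k * P) p ≡ p
    rot-period k p = trans (mod-cong (trans (cong (_% P) (+-comm (k * P) (toℕ p))) ([m+kn]%n≡m%n (toℕ p) k P))) (toℕ-mod-id p)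

    -- The inverse rotation takes t(P - 1) steps forward instead of t steps back: together with
    -- `rot t` this makes tP steps, and no subtraction appears.
    unrot : ℕ → Fin P → Fin P
    unrot t = rot (t * pred P)

    rot-unrot : ∀ t p → rot t (unrot t p) ≡ p
    rot-unrot t p = trans (rot-rot t _ p) (trans (cong (λ k → rot k p) (trans (sym (*-suc t (pred P))) (cong (t *_) (suc-pred P)))) (rot-period t p))

    unrot-rot : ∀ t p → unrot t (rot t p) ≡ p
    unrot-rot t p = trans (rot-rot _ t p) (trans (cong (λ k → rot k p) (trans (+-comm (t * pred P) t) (trans (sym (*-suc t (pred P))) (cong (t *_) (suc-pred P))))) (rot-period t p))

    rotation : ℕ → Permutation P P
    rotation t = permutation (rot t) (unrot t) (rot-unrot t) (unrot-rot t)

    module Jumps (s : ℕ) (2D≤P : s * 2 * 2 ≤ P) (evenP : odd P ≡ false) where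

      D : ℕ
      D = s * 2

      jumpArc : Fin P → Fin P → Bool
      jumpArc p p′ = isJump D (dist (toℕ p) (toℕ p′))

      specF : ∀ (p p′ : Fin P) → Spec (toℕ p) (toℕ p′) (dist (toℕ p) (toℕ p′))
      specF p p′ = dist-spec (toℕ p′) (toℕ<n p)

      jump< : ∀ p p′ → T (jumpArc p p′) → dist (toℕ p) (toℕ p′) < D
      jump< p p′ = isJump⇒< D (dist (toℕ p) (toℕ p′))

      jump-odd : ∀ p p′ → T (jumpArc p p′) → odd (dist (toℕ p) (toℕ p′)) ≡ true
      jump-odd p p′ = isJump⇒odd D (dist (toℕ p) (toℕ p′))

      -- A jump and a jump back add up to a multiple of P. Each is below D and 2D ≤ P, so the sum is
      -- 0, although both lengths are odd.
      both : ∀ p p′ → T (jumpArc p p′) → T (jumpArc p′ p) → ⊥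
      both p p′ t t′ with specF p p′ | specF p′ p | jump< p p′ t | jump< p′ p t′
      ... | sp | sp′ | l | l′ = go sp sp′
        where
        δ = dist (toℕ p) (toℕ p′)
        δ′ = dist (toℕ p′) (toℕ p)
        δ+δ′<P : δ + δ′ < P
        δ+δ′<P = <-≤-trans (+-mono-< l l′) (≤-trans (≤-reflexive (m+m≡m*2 D)) 2D≤P)
        around : ∀ {x} → toℕ p + δ + δ′ ≡ toℕ p + x → δ + δ′ ≡ x
        around e = +-cancelˡ-≡ (toℕ p) _ _ (trans (sym (+-assoc (toℕ p) δ δ′)) e)
        go : Spec (toℕ p) (toℕ p′) δ → Spec (toℕ p′) (toℕ p) δ′ → ⊥
        go (inj₁ e) (inj₁ e′) with trans (sym (isJump⇒odd D δ t)) (cong odd (m+n≡0⇒m≡0 δ (around (trans (cong (_+ δ′) e) (trans e′ (sym (+-identityʳ _)))))))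
        ... | ()
        go (inj₁ e) (inj₂ e′) = <-irrefl (around (trans (cong (_+ δ′) e) (trans e′ (+-comm P (toℕ p))))) δ+δ′<P
        go (inj₂ e) (inj₁ e′) = <-irrefl (around (trans (cong (_+ δ′) e) (trans (+-assoc P (toℕ p′) δ′) (trans (cong (P +_) e′) (+-comm P (toℕ p)))))) δ+δ′<P
        go (inj₂ e) (inj₂ e′) = <⇒≱ δ+δ′<P (≤-trans (m≤m+n P P) (≤-reflexive (sym (around
          (trans (cong (_+ δ′) e) (trans (+-assoc P (toℕ p′) δ′) (trans (cong (P +_) e′) (trans (sym (+-assoc P P _)) (+-comm (P + P) (toℕ p))))))))))

      cyc : OGraph P
      cyc = record
        { arc     = jumpArc
        ; irrefl  = λ p → cong (isJump D) (dist-self (toℕ p))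
        ; antisym = λ p p′ t → anti p p′ t
        }
        where
        anti : ∀ p p′ → T (jumpArc p p′) → jumpArc p′ p ≡ false
        anti p p′ t with jumpArc p′ p in e
        ... | false = refl
        ... | true  = ⊥-elim (both p p′ t (subst T (sym e) tt))

      oddpos : Fin P → Bool
      oddpos p = odd (toℕ p)

      -- An odd jump flips the parity, and wrapping around subtracts P, which `evenP` makes
      -- harmless.
      jump-parity : ∀ p p′ → T (jumpArc p p′) → oddpos p ≢ oddpos p′
      jump-parity p p′ t eq with specF p p′ | jump-odd p p′ t
      ... | sp | o = not-¬ {oddpos p′} refl (trans (trans (sym (eq′ sp)) (odd-+ (toℕ p) _)) (trans (cong (oddpos p xor_) o) (trans (cong (_xor true) eq) (xor-comm (oddpos p′) true))))
        where
        δ = dist (toℕ p) (toℕ p′)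
        eq′ : Spec (toℕ p) (toℕ p′) δ → odd (toℕ p + δ) ≡ oddpos p′
        eq′ (inj₁ e) = cong odd e
        eq′ (inj₂ e) = trans (cong odd e) (trans (odd-+ P (toℕ p′)) (cong (_xor oddpos p′) evenP))

      cyc-parity : ∀ p p′ → T (adj cyc p p′) → oddpos p ≢ oddpos p′
      cyc-parity p p′ t with Equivalence.to (T-∨ {jumpArc p p′} {jumpArc p′ p}) t
      ... | inj₁ t′ = jump-parity p p′ t′
      ... | inj₂ t′ = jump-parity p′ p t′ ∘ sym

      rot1-aut : IsAut cyc (rot 1)
      rot1-aut p p′ = cong (isJump D) (trans (cong₂ dist (toℕ-mod (suc (toℕ p))) (toℕ-mod (suc (toℕ p′)))) (dist-suc (toℕ<n p) (toℕ<n p′)))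

      rot-aut : ∀ t → IsAut cyc (rot t)
      rot-aut zero    p p′ rewrite toℕ-mod-id p | toℕ-mod-id p′ = refl
      rot-aut (suc t) p p′ = trans (sym (cong₂ jumpArc (rot-rot 1 t p) (rot-rot 1 t p′))) (trans (rot1-aut _ _) (rot-aut t p p′))

      degree-rot : ∀ t p → degree cyc (rot t p) ≡ degree cyc p
      degree-rot t p = trans (countFin-permute P _ (rotation t)) (countFin-cong P (λ u → cong₂ _∨_ (rot-aut t u p) (rot-aut t p u)))

      -- Degrees are counted at position D because its in- and out-neighbours lie in 0, ..., 2D - 1
      -- with no wrap-around; as D is even they are exactly the odd numbers below 2D. Position p is
      -- reached from D by D(P - 1) + p steps.
      degree-origin : ∀ p → degree cyc p ≡ degree cyc (D mod P)
      degree-origin p = sym (trans (sym (degree-rot (D * pred P + toℕ p) (D mod P))) (cong (degree cyc) (trans (rot-mod _ D) target)))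
        where
        target : (D * pred P + toℕ p + D) mod P ≡ p
        target = trans (cong (_mod P) (begin
          D * pred P + toℕ p + D   ≡⟨ +-assoc (D * pred P) (toℕ p) D ⟩
          D * pred P + (toℕ p + D) ≡⟨ cong (D * pred P +_) (+-comm (toℕ p) D) ⟩
          D * pred P + (D + toℕ p) ≡⟨ sym (+-assoc (D * pred P) D (toℕ p)) ⟩
          D * pred P + D + toℕ p   ≡⟨ cong (_+ toℕ p) (trans (+-comm (D * pred P) D) (trans (sym (*-suc D (pred P))) (cong (D *_) (suc-pred P)))) ⟩
          D * P + toℕ p            ∎)) (rot-period D p)
          where open ≡-Reasoning

      D<P : D < P
      D<P = go D 2D≤P
        where
        go : ∀ x → x * 2 ≤ P → x < P
        go zero    _ = >-nonZero⁻¹ P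
        go (suc x) h = <-≤-trans (s≤s (s≤s (m≤m*n x 2))) h

      adj-origin : ∀ u → u < P → (isJump D (dist u D) ∨ isJump D (dist D u)) ≡ (odd u ∧ (u <ᵇ D * 2))
      adj-origin u u<P with u ≤? D | D ≤? u
      ... | yes u≤D | yes D≤u with ≤-antisym u≤D D≤u
      ...   | refl rewrite n∸n≡0 D | odd-*2 s = refl
      adj-origin u u<P | no u≰D | no D≰u = contradiction (<⇒≤ (≰⇒> u≰D)) D≰u
      adj-origin u u<P | yes u≤D | no D≰u = begin
        isJump D (D ∸ u) ∨ isJump D ((P + u) ∸ D)  ≡⟨ cong (isJump D (D ∸ u) ∨_) (¬<⇒¬isJump D _ far) ⟩
        isJump D (D ∸ u) ∨ false                   ≡⟨ ∨-identityʳ _ ⟩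
        odd (D ∸ u) ∧ (D ∸ u <ᵇ D)                 ≡⟨ cong (_∧ (D ∸ u <ᵇ D)) (odd-∸ u≤D (odd-*2 s)) ⟩
        odd u ∧ (D ∸ u <ᵇ D)                       ≡⟨ near ⟩
        odd u ∧ (u <ᵇ D * 2)                       ∎
        where
        open ≡-Reasoning
        far : D ≤ (P + u) ∸ D
        far = m+n≤o⇒m≤o∸n D (≤-trans (≤-reflexive (m+m≡m*2 D)) (≤-trans 2D≤P (m≤m+n P u)))
        near : (odd u ∧ (D ∸ u <ᵇ D)) ≡ (odd u ∧ (u <ᵇ D * 2))
        near with odd u in e
        ... | false = refl
        ... | true  = trans (Equivalence.to T-≡ (<⇒<ᵇ (∸-monoʳ-< {D} {u} {0} (n≢0⇒n>0 λ { refl → contradiction e λ () }) u≤D)))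
                            (sym (Equivalence.to T-≡ (<⇒<ᵇ (<-≤-trans (≰⇒> D≰u) (m≤m*n D 2)))))
      adj-origin u u<P | no u≰D | yes D≤u = begin
        isJump D ((P + D) ∸ u) ∨ isJump D (u ∸ D)  ≡⟨ cong (_∨ isJump D (u ∸ D)) (¬<⇒¬isJump D _ far) ⟩
        odd (u ∸ D) ∧ (u ∸ D <ᵇ D)                 ≡⟨ cong₂ _∧_ par rng ⟩
        odd u ∧ (u <ᵇ D * 2)                       ∎
        where
        open ≡-Reasoning
        far : D ≤ (P + D) ∸ u
        far = m+n≤o⇒m≤o∸n D (≤-trans (+-monoʳ-≤ D (<⇒≤ u<P)) (≤-reflexive (+-comm D P)))
        par : odd (u ∸ D) ≡ odd u
        par = sym (trans (cong odd (sym (m+[n∸m]≡n D≤u))) (trans (odd-+ D (u ∸ D)) (cong (_xor odd (u ∸ D)) (odd-*2 s))))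
        rng : (u ∸ D <ᵇ D) ≡ (u <ᵇ D * 2)
        rng with u ∸ D <ᵇ D in e | u <ᵇ D * 2 in e′
        ... | true  | true  = refl
        ... | false | false = refl
        ... | true  | false = contradiction (subst T e′ (<⇒<ᵇ (subst₂ _<_ (m+[n∸m]≡n D≤u) (m+m≡m*2 D) (+-monoʳ-< D (<ᵇ⇒< (u ∸ D) D (subst T (sym e) tt)))))) id
        ... | false | true  = contradiction (subst T e (<⇒<ᵇ (+-cancelˡ-< D _ _ (subst₂ _<_ (sym (m+[n∸m]≡n D≤u)) (sym (m+m≡m*2 D)) (<ᵇ⇒< u _ (subst T (sym e′) tt)))))) id

      count-odd : ∀ k {N} → k * 2 ≤ N → countFin N (λ u → odd (toℕ u) ∧ (toℕ u <ᵇ k * 2)) ≡ k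
      count-odd zero    {N} h = countFin-false N (λ u → ∧-zeroʳ _)
      count-odd (suc k) {suc (suc N)} (s≤s (s≤s h)) =
        cong suc (trans (countFin-cong N (λ u → cong (_∧ (toℕ u <ᵇ k * 2)) (not-involutive (odd (toℕ u))))) (count-odd k h))

      cyc-degree : ∀ p → degree cyc p ≡ D
      cyc-degree p = trans (degree-origin p) (trans (countFin-cong P eq) (count-odd D 2D≤P))
        where
        eq : ∀ u → adj cyc u (D mod P) ≡ (odd (toℕ u) ∧ (toℕ u <ᵇ D * 2))
        eq u rewrite toℕ-mod D | m<n⇒m%n≡m D<P = adj-origin (toℕ u) (toℕ<n u)

      jump-range : ∀ p p′ → T (jumpArc p p′) → toℕ p + D ≤ P → toℕ p ≤ toℕ p′ × toℕ p′ < toℕ p + D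
      jump-range p p′ t p+D≤P with specF p p′ | jump< p p′ t
      ... | inj₁ e | l = ≤-trans (m≤m+n (toℕ p) _) (≤-reflexive e) , ≤-<-trans (≤-reflexive (sym e)) (+-monoʳ-< (toℕ p) l)
      ... | inj₂ e | l = contradiction (<-≤-trans (+-monoʳ-< (toℕ p) l) p+D≤P) (≤⇒≯ (≤-trans (m≤m+n P (toℕ p′)) (≤-reflexive (sym e))))

      jump-range-back : ∀ p p′ → T (jumpArc p′ p) → D ≤ toℕ p → toℕ p ≤ toℕ p′ + D × toℕ p′ ≤ toℕ p
      jump-range-back p p′ t D≤p with specF p′ p | jump< p′ p t
      ... | inj₁ e | l = ≤-trans (≤-reflexive (sym e)) (+-monoʳ-≤ (toℕ p′) (<⇒≤ l)) , ≤-trans (m≤m+n (toℕ p′) _) (≤-reflexive e)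
      ... | inj₂ e | l = contradiction (begin-strict
        P + toℕ p                      ≡⟨ sym e ⟩
        toℕ p′ + dist (toℕ p′) (toℕ p) <⟨ +-mono-< (toℕ<n p′) l ⟩
        P + D                          ≤⟨ +-monoʳ-≤ P D≤p ⟩
        P + toℕ p                      ∎) (<-irrefl refl)
        where open ≤-Reasoning

  -- Views in the ladder graph

  Injective : ∀ {n} → (Fin n → Fin n) → Set
  Injective f = ∀ i j → f i ≡ f j → i ≡ j

  Within-aut : ∀ {n} (G : OGraph n) {f} → IsAut G f → ∀ {r v u} → Within G r v u → Within G r (f v) (f u)
  Within-aut G aut here = here
  Within-aut G {f} aut (step {w = w} {u = u} p t) = step (Within-aut G aut p) (subst T (sym (cong₂ _∨_ (aut w u) (aut u w))) t)

  -- The inverse `g` is again an automorphism; it provides the preimages in the source ball that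
  -- `SameView` asks for.
  aut-view : ∀ {n} (G : OGraph n) {f g : Fin n → Fin n} → IsAut G f → (∀ u → f (g u) ≡ u) → (∀ u → g (f u) ≡ u) →
    ∀ r {id₁ id₂} → (∀ u → id₂ (f u) ≡ id₁ u) → ∀ v → SameView r G id₁ v G id₂ (f v)
  aut-view G {f} {g} aut fg gf r ids v = f , refl , (λ u → Within-aut G aut)
    , (λ u′ p → g u′ , subst (λ w → Within G r w (g u′)) (gf v) (Within-aut G aut′ p) , fg u′)
    , (λ u _ → ids u) , (λ u w _ _ → aut u w)
    where
    aut′ : IsAut G g
    aut′ u w = trans (sym (aut (g u) (g w))) (cong₂ (arc G) (fg u) (fg w))

  agree-view : ∀ {n} (G : OGraph n) r {id₁ id₂} v → (∀ u → Within G r v u → id₂ u ≡ id₁ u) → SameView r G id₁ v G id₂ v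
  agree-view G r v ids = id , refl , (λ u p → p) , (λ u p → u , p , refl) , ids , (λ _ _ _ _ → refl)

  countFin-∧ : ∀ {n} b {p : Fin n → Bool} → countFin n p ≡ 1 → countFin n (λ i → b ∧ p i) ≡ ind b
  countFin-∧     true  e = e
  countFin-∧ {n} false e = countFin-false n (λ _ → refl)

  -- Two copies of the circulant on ℤ/P whose arcs are the odd jumps p → p + δ, δ < D = 2s,
  -- joined for odd d by the arcs (false, p) → (true, p); the junk component adjusts the vertex count.
  module Instance
    (P : ℕ) .{{_ : NonZero P}} (s : ℕ) (2D≤P : s * 2 * 2 ≤ P) (evenP : odd P ≡ false)
    (flag : Bool) (J : ℕ) (junk : OGraph J) (junkClass : InClass (s * 2 + ind flag) junk)
    where

    open Cycle P public
    open Jumps s 2D≤P evenP public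

    n d : ℕ
    n = P + P + J
    d = D + ind flag

    match : Fin P → Fin P → Bool
    match p p′ = flag ∧ eqᵇ p p′

    ladder : OGraph (P + P)
    ladder = block cyc match cyc

    G : OGraph n
    G = block ladder (λ _ _ → false) junk

    private
      module L = Block cyc match cyc
      module GB = Block ladder (λ _ _ → false) junk

    countFin-match : ∀ p → countFin P (match p) ≡ ind flag
    countFin-match p = countFin-∧ {P} flag {eqᵇ p} (countFin-eqᵇ P p)

    match-sym : ∀ p p′ → match p p′ ≡ match p′ p
    match-sym p p′ = cong (flag ∧_) (eqᵇ-sym p p′)

    match⇒≡ : ∀ p p′ → T (match p p′) → p ≡ p′
    match⇒≡ p p′ t = eqᵇ⇒≡ p p′ (proj₂ (Equivalence.to (T-∧ {flag}) t))

    ladder-regular : Regular d ladder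
    ladder-regular = L.block-regular
      (λ p → cong₂ _+_ (cyc-degree p) (countFin-match p))
      (λ p → trans (cong₂ _+_ (trans (countFin-cong P (λ u → match-sym u p)) (countFin-match p)) (cyc-degree p)) (+-comm (ind flag) D))

    ladder-bipartite : Bipartite ladder
    ladder-bipartite = L.block-bipartite (oddpos , cyc-parity)
      ((λ p → not (oddpos p)) , λ p p′ t e → cyc-parity p p′ t (not-injective e))
      (λ p p′ t e → not-¬ {oddpos p} refl (trans e (cong (not ∘ oddpos) (sym (match⇒≡ p p′ t)))))

    G-class : InClass d G
    G-class = GB.block-regular
        (λ u → trans (cong₂ _+_ (ladder-regular u) (countFin-false J (λ _ → refl))) (+-identityʳ d))
        (λ u → cong₂ _+_ (countFin-false (P + P) (λ _ → refl)) (proj₁ junkClass u))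
      , GB.block-bipartite ladder-bipartite (proj₂ junkClass) (λ _ _ ())

    track : Bool → Fin P → Fin (P + P)
    track false p = p ↑ˡ P
    track true  p = P ↑ʳ p

    vtx : Bool → Fin P → Fin n
    vtx x p = track x p ↑ˡ J

    Φ : (Fin P → Fin P) → Fin n → Fin n
    Φ π = joinMap (joinMap π π) id

    Φ-vtx : ∀ π x p → Φ π (vtx x p) ≡ vtx x (π p)
    Φ-vtx π x p = trans (joinMap-↑ˡ (joinMap π π) id (track x p)) (cong (_↑ˡ J) (tr x))
      where
      tr : ∀ x → joinMap π π (track x p) ≡ track x (π p)
      tr false = joinMap-↑ˡ π π p
      tr true  = joinMap-↑ʳ π π p

    vtx-elim : (Q : Fin n → Set) → (∀ x p → Q (vtx x p)) → (∀ j → Q (P + P ↑ʳ j)) → ∀ u → Q u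
    vtx-elim Q l r = ↑-elim (P + P) Q (↑-elim P (λ u → Q (u ↑ˡ J)) (l false) (l true)) r

    Φ-∘ : ∀ π σ u → Φ π (Φ σ u) ≡ Φ (π ∘ σ) u
    Φ-∘ π σ = vtx-elim _
      (λ x p → trans (cong (Φ π) (Φ-vtx σ x p)) (trans (Φ-vtx π x (σ p)) (sym (Φ-vtx (π ∘ σ) x p))))
      (λ j → trans (cong (Φ π) (joinMap-↑ʳ (joinMap σ σ) id j)) (trans (joinMap-↑ʳ (joinMap π π) id j) (sym (joinMap-↑ʳ (joinMap (π ∘ σ) (π ∘ σ)) id j))))

    Φ-inverse : ∀ {π σ} → (∀ p → π (σ p) ≡ p) → ∀ u → Φ π (Φ σ u) ≡ u
    Φ-inverse {π} {σ} h u = trans (Φ-∘ π σ u) (joinMap-id (joinMap-id h h) (λ _ → refl) u)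

    Φ-injective : ∀ {π} → Injective π → Injective (Φ π)
    Φ-injective h = joinMap-injective (joinMap-injective h h) (λ _ _ e → e)

    rot-injective : ∀ t → Injective (rot t)
    rot-injective t p p′ e = trans (sym (unrot-rot t p)) (trans (cong (unrot t) e) (unrot-rot t p′))

    Φ-rot-aut : ∀ t → IsAut G (Φ (rot t))
    Φ-rot-aut t = block-aut ladder _ junk
      (block-aut cyc match cyc (rot-aut t) (λ p p′ → cong (flag ∧_) (eqᵇ-injective (rot t) (rot-injective t) p p′)) (rot-aut t))
      (λ _ _ → refl) (λ _ _ → refl)

    -- The two vertices at position p receive the pair of identifiers that belongs to position π p,
    -- and the junk keeps its own. Assignments of this kind are just permutations of positions, so
    -- one sequence of symbols describes both tracks.
    ids : (Fin P → Fin P) → Fin n → ℕ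
    ids π u = suc (toℕ (Φ π u))

    ids-valid : ∀ {k π} → 1 ≤ k → Injective π → ValidIds k n (ids π)
    ids-valid {k} {π} k≥1 h = (λ u → s≤s z≤n , ≤-trans (toℕ<n (Φ π u)) n≤n^k)
      , λ u v e → Φ-injective h u v (toℕ-injective (suc-injective e))
      where
      n≤n^k : n ≤ n ^ k
      n≤n^k = ≤-trans (≤-reflexive (sym (^-identityʳ n))) (^-monoʳ-≤ n {{n≢0}} k≥1)
        where
        n≢0 : NonZero n
        n≢0 = >-nonZero (≤-trans (>-nonZero⁻¹ P) (≤-trans (m≤m+n P P) (m≤m+n (P + P) J)))

    adj-vtx : ∀ y p u → T (adj G (vtx y p) u) →
      ∃ λ y′ → ∃ λ p′ → u ≡ vtx y′ p′ × (T (adj cyc p p′) ⊎ p ≡ p′)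
    adj-vtx y p = vtx-elim _
      (λ y′ p′ t → y′ , p′ , refl , go y y′ p′ (subst T (GB.adj-ll (track y p) (track y′ p′)) t))
      (λ j t → ⊥-elim (subst T (GB.adj-lr (track y p) j) t))
      where
      go : ∀ y y′ p′ → T (adj ladder (track y p) (track y′ p′)) → T (adj cyc p p′) ⊎ p ≡ p′
      go false false p′ t = inj₁ (subst T (L.adj-ll p p′) t)
      go false true  p′ t = inj₂ (match⇒≡ p p′ (subst T (L.adj-lr p p′) t))
      go true  false p′ t = inj₂ (sym (match⇒≡ p′ p (subst T (L.adj-rl p′ p) t)))
      go true  true  p′ t = inj₁ (subst T (L.adj-rr p p′) t)

    cyc-range : ∀ p p′ → T (adj cyc p p′) → D ≤ toℕ p → toℕ p + D ≤ P → toℕ p ≤ toℕ p′ + D × toℕ p′ ≤ toℕ p + D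
    cyc-range p p′ t lo hi with Equivalence.to (T-∨ {jumpArc p p′} {jumpArc p′ p}) t
    ... | inj₁ t′ = ≤-trans (proj₁ (jump-range p p′ t′ hi)) (m≤m+n _ D) , <⇒≤ (proj₂ (jump-range p p′ t′ hi))
    ... | inj₂ t′ = proj₁ (jump-range-back p p′ t′ lo) , ≤-trans (proj₂ (jump-range-back p p′ t′ lo)) (m≤m+n _ D)

    module Radius (r : ℕ) (2R+D≤P : r * D + r * D + D ≤ P) (R<P : r * D < P) where

      R : ℕ
      R = r * D

      centre : Fin P
      centre = R mod P

      toℕ-centre : toℕ centre ≡ R
      toℕ-centre = trans (toℕ-mod R) (m<n⇒m%n≡m R<P)

      -- One step moves the position by at most D, as long as it does not cross the end of the
      -- cycle. With the centre at R and 2R + D ≤ P, every position from which a step is taken is at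
      -- distance at least D from both ends, so the whole view lies over 0, ..., 2R and never
      -- reaches the junk.
      ball : ∀ {t x u} → t ≤ r → Within G t (vtx x centre) u →
        ∃ λ y → ∃ λ p → u ≡ vtx y p × R ≤ toℕ p + t * D × toℕ p ≤ R + t * D
      ball {t} {x} _ here = x , centre , refl
        , ≤-trans (≤-reflexive (sym toℕ-centre)) (m≤m+n _ (t * D))
        , ≤-trans (≤-reflexive toℕ-centre) (m≤m+n R (t * D))
      ball {suc t} {x} {u} t<r (step w a) with ball {t} {x} (<⇒≤ t<r) w
      ... | y , p , refl , lo , hi with adj-vtx y p u a
      ...   | y′ , p′ , refl , inj₂ refl = y′ , p , refl
        , ≤-trans lo (+-monoʳ-≤ (toℕ p) (m≤n+m (t * D) D))
        , ≤-trans hi (+-monoʳ-≤ R (m≤n+m (t * D) D))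
      ...   | y′ , p′ , refl , inj₁ c = y′ , p′ , refl
        , ≤-trans lo (≤-trans (+-monoˡ-≤ (t * D) (proj₁ rng)) (≤-reflexive (+-assoc (toℕ p′) D (t * D))))
        , ≤-trans (proj₂ rng) (≤-trans (+-monoˡ-≤ D hi) (≤-reflexive (trans (+-assoc R (t * D) D) (cong (R +_) (+-comm (t * D) D)))))
        where
        tD+D≤R : D + t * D ≤ R
        tD+D≤R = *-monoˡ-≤ D t<r
        D≤p : D ≤ toℕ p
        D≤p = +-cancelʳ-≤ (t * D) _ _ (≤-trans tD+D≤R lo)
        p+D≤P : toℕ p + D ≤ P
        p+D≤P = ≤-trans (+-monoˡ-≤ D (≤-trans hi (+-monoʳ-≤ R (≤-trans (m≤n+m (t * D) D) tD+D≤R)))) 2R+D≤P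
        rng = cyc-range p p′ c D≤p p+D≤P

      module Colours {k} (k≥1 : 1 ≤ k) (A : LocalAlg k n r) where

        col : (Fin P → Fin P) → Bool → Fin P → Bool
        col π x p = out A G (ids π) (vtx x p)

        col-rot : ∀ {π} → Injective π → ∀ x t p → col π x (rot t p) ≡ col (π ∘ rot t) x p
        col-rot {π} h x t p = sym (trans
          (locality A G (ids (π ∘ rot t)) G (ids π) _ _ (ids-valid k≥1 h′) (ids-valid k≥1 h)
            (aut-view G (Φ-rot-aut t) (Φ-inverse (rot-unrot t)) (Φ-inverse (unrot-rot t)) r {ids (π ∘ rot t)} {ids π} (λ u → cong (suc ∘ toℕ) (Φ-∘ π (rot t) u)) (vtx x p)))
          (cong (out A G (ids π)) (Φ-vtx (rot t) x p)))
          where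
          h′ : Injective (π ∘ rot t)
          h′ i j e = rot-injective t i j (h _ _ e)

        col-agree : ∀ {π π′} → Injective π → Injective π′ → (∀ p → toℕ p ≤ R + R → π p ≡ π′ p) →
          ∀ x → col π x centre ≡ col π′ x centre
        col-agree {π} {π′} h h′ ag x = locality A G (ids π) G (ids π′) _ _ (ids-valid k≥1 h) (ids-valid k≥1 h′)
          (agree-view G r (vtx x centre) same)
          where
          same : ∀ u → Within G r (vtx x centre) u → ids π′ u ≡ ids π u
          same u w with ball {r} {x} ≤-refl w
          ... | y , p , refl , _ , hi = cong (suc ∘ toℕ) (trans (Φ-vtx π′ y p) (trans (cong (vtx y) (sym (ag p hi))) (sym (Φ-vtx π y p))))

        -- Rotations are automorphisms, so both windows can be moved to `centre`, where `col-agree`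
        -- compares them. This is the only information about the algorithm that the arrangement of
        -- identifiers uses.
        col-window : ∀ {π π′} → Injective π → Injective π′ → ∀ t t′ →
          (∀ i → i ≤ R + R → π ((t + i) mod P) ≡ π′ ((t′ + i) mod P)) →
          ∀ x → col π x ((t + R) mod P) ≡ col π′ x ((t′ + R) mod P)
        col-window {π} {π′} h h′ t t′ ag x = begin
          col π x ((t + R) mod P)       ≡⟨ cong (col π x) (sym (rot-mod t R)) ⟩
          col π x (rot t centre)        ≡⟨ col-rot h x t centre ⟩
          col (π ∘ rot t) x centre      ≡⟨ col-agree (comp h t) (comp h′ t′) (λ p → ag (toℕ p)) x ⟩
          col (π′ ∘ rot t′) x centre    ≡⟨ sym (col-rot h′ x t′ centre) ⟩
          col π′ x (rot t′ centre)      ≡⟨ cong (col π′ x) (rot-mod t′ R) ⟩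
          col π′ x ((t′ + R) mod P)     ∎
          where
          open ≡-Reasoning
          comp : ∀ {π} → Injective π → ∀ t → Injective (π ∘ rot t)
          comp h t i j e = rot-injective t i j (h _ _ e)

  -- Arranging the identifiers

  -- The value 0 past the end of the list is never used.
  nth : List ℕ → ℕ → ℕ
  nth []       i       = 0
  nth (x ∷ xs) zero    = x
  nth (x ∷ xs) (suc i) = nth xs i

  nth-drop : ∀ m xs i → nth (drop m xs) i ≡ nth xs (m + i)
  nth-drop zero    xs       i = refl
  nth-drop (suc m) []       i = refl
  nth-drop (suc m) (x ∷ xs) i = nth-drop m xs i

  nth-front : ∀ xs i → suc i < length xs → nth (front xs) i ≡ nth xs i
  nth-front (x ∷ [])     i       (s≤s ())
  nth-front (x ∷ y ∷ ys) zero    lt       = refl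
  nth-front (x ∷ y ∷ ys) (suc i) (s≤s lt) = nth-front (y ∷ ys) i lt

  nth-All : ∀ {Q : ℕ → Set} {xs} → All Q xs → ∀ i → i < length xs → Q (nth xs i)
  nth-All (q ∷ qs) zero    lt       = q
  nth-All (q ∷ qs) (suc i) (s≤s lt) = nth-All qs i lt

  nth-map-toℕ : ∀ {M} (h : ℕ → ℕ) (xs : List (Fin M)) i → i < length xs → nth (map (h ∘ toℕ) xs) i ≡ h (nth (map toℕ xs) i)
  nth-map-toℕ h (x ∷ xs) zero    lt       = refl
  nth-map-toℕ h (x ∷ xs) (suc i) (s≤s lt) = nth-map-toℕ h xs i lt

  length-front : ∀ {A : Set} (xs : List A) → length (front xs) ≡ pred (length xs)
  length-front []           = refl
  length-front (x ∷ [])     = refl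
  length-front (x ∷ y ∷ ys) = cong suc (length-front (y ∷ ys))

  map-front : ∀ {A B : Set} (f : A → B) xs → map f (front xs) ≡ front (map f xs)
  map-front f []           = refl
  map-front f (x ∷ [])     = refl
  map-front f (x ∷ y ∷ ys) = cong (f x ∷_) (map-front f (y ∷ ys))

  map-drop1 : ∀ {A B : Set} (f : A → B) xs → map f (drop 1 xs) ≡ drop 1 (map f xs)
  map-drop1 f []       = refl
  map-drop1 f (x ∷ xs) = refl

  drop-drop1 : ∀ {A : Set} i (xs : List A) → drop i (drop 1 xs) ≡ drop (suc i) xs
  drop-drop1 zero    []       = refl
  drop-drop1 (suc i) []       = refl
  drop-drop1 i       (x ∷ xs) = refl

  All-front : ∀ {A : Set} {Q : A → Set} {xs} → All Q xs → All Q (front xs)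
  All-front []                 = []
  All-front (q ∷ [])           = []
  All-front (q ∷ qs@(_ ∷ _))   = q ∷ All-front qs

  AllPairs-front : ∀ {A : Set} {Q : A → A → Set} {xs} → AllPairs Q xs → AllPairs Q (front xs)
  AllPairs-front []               = []
  AllPairs-front (q ∷ [])         = []
  AllPairs-front (q ∷ qs@(_ ∷ _)) = All-front q ∷ AllPairs-front qs

  swap : ℕ → ℕ → ℕ → ℕ
  swap a b y with y ≟ a
  ... | yes _ = b
  ... | no  _ with y ≟ b
  ...   | yes _ = a
  ...   | no  _ = y

  swap-left : ∀ a b → swap a b a ≡ b
  swap-left a b with a ≟ a
  ... | yes _ = refl
  ... | no ¬p = contradiction refl ¬p

  swap-other : ∀ {a b y} → y ≢ a → y ≢ b → swap a b y ≡ y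
  swap-other {a} {b} {y} y≢a y≢b with y ≟ a
  ... | yes p = contradiction p y≢a
  ... | no  _ with y ≟ b
  ...   | yes p = contradiction p y≢b
  ...   | no  _ = refl

  swap-injective : ∀ a b {y z} → swap a b y ≡ swap a b z → y ≡ z
  swap-injective a b {y} {z} e with y ≟ a | z ≟ a
  swap-injective a b {y} {z} e | yes refl | yes refl = refl
  swap-injective a b {y} {z} e | yes refl | no z≢a with z ≟ b
  ... | yes refl = sym e
  ... | no z≢b   = contradiction (sym e) z≢b
  swap-injective a b {y} {z} e | no y≢a | yes refl with y ≟ b
  ... | yes refl = sym e
  ... | no y≢b   = contradiction e y≢b
  swap-injective a b {y} {z} e | no y≢a | no z≢a with y ≟ b | z ≟ b
  ... | yes refl | yes refl = refl
  ... | yes refl | no _     = contradiction (sym e) z≢a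
  ... | no _     | yes refl = contradiction e y≢a
  ... | no _     | no _     = e

  swap-< : ∀ {N a b y} → a < N → b < N → y < N → swap a b y < N
  swap-< {N} {a} {b} {y} a<N b<N y<N with y ≟ a
  ... | yes _ = b<N
  ... | no  _ with y ≟ b
  ...   | yes _ = a<N
  ...   | no  _ = y<N

  -- A permutation of ℕ sending o + i to the i-th entry of the list; it swaps values
  -- one entry at a time, so it is injective for every list.
  place : ℕ → List ℕ → ℕ → ℕ
  place o []       y = y
  place o (x ∷ xs) y = swap (place (suc o) xs o) x (place (suc o) xs y)

  place-injective : ∀ o xs {y z} → place o xs y ≡ place o xs z → y ≡ z
  place-injective o []       e = e
  place-injective o (x ∷ xs) e = place-injective (suc o) xs (swap-injective (place (suc o) xs o) x e)

  place-< : ∀ {N} o xs → All (_< N) xs → o + length xs ≤ N → ∀ {y} → y < N → place o xs y < N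
  place-< o []       []       h y<N = y<N
  place-< {N} o (x ∷ xs) (q ∷ qs) h y<N =
    swap-< (place-< (suc o) xs qs h′ (≤-trans (s≤s (m≤m+n o (length xs))) h′)) q (place-< (suc o) xs qs h′ y<N)
    where
    h′ : suc o + length xs ≤ N
    h′ = ≤-trans (≤-reflexive (sym (+-suc o (length xs)))) h

  -- The swap that puts x at position o spares the entries placed before it: such an entry differs
  -- from the old value at o by injectivity, and from x because the list has distinct entries.
  place-nth : ∀ o xs → AllPairs _≢_ xs → ∀ i → i < length xs → place o xs (o + i) ≡ nth xs i
  place-nth o (x ∷ xs) (q ∷ qs) zero lt = trans (cong (λ y → swap (place (suc o) xs o) x (place (suc o) xs y)) (+-identityʳ o)) (swap-left (place (suc o) xs o) x)
  place-nth o (x ∷ xs) (q ∷ qs) (suc i) (s≤s lt) = trans (swap-other ≢o ≢x) rec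
    where
    rec : place (suc o) xs (o + suc i) ≡ nth xs i
    rec = trans (cong (place (suc o) xs) (+-suc o i)) (place-nth (suc o) xs qs i lt)
    ≢x : place (suc o) xs (o + suc i) ≢ x
    ≢x e = nth-All q i lt (trans (sym e) rec)
    ≢o : place (suc o) xs (o + suc i) ≢ place (suc o) xs o
    ≢o e = m+1+n≢m o (place-injective (suc o) xs e)

  -- A permutation of the numbers below N, kept as an injection of ℕ so that shifting by an offset
  -- and cutting off a prefix are plain arithmetic.
  record Arrangement (N : ℕ) : Set where
    field
      fun       : ℕ → ℕ
      injective : ∀ {i j} → fun i ≡ fun j → i ≡ j
      bounded   : ∀ {i} → i < N → fun i < N
  open Arrangement

  identity : ∀ N → Arrangement N
  identity N = record { fun = id ; injective = id ; bounded = id }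

  placeA : ∀ {N} xs → All (_< N) xs → length xs ≤ N → Arrangement N
  placeA xs q h = record { fun = place 0 xs ; injective = place-injective 0 xs ; bounded = place-< 0 xs q h }

  -- Precomposition permutes positions: the first u positions keep the identifiers given by `a`, and
  -- the identifiers behind them are rearranged among themselves by `b`.
  module _ {N} (a : Arrangement N) (u : ℕ) (b : Arrangement (N ∸ u)) (u≤N : u ≤ N) where

    private
      glueF : ℕ → ℕ
      glueF y with y <? u
      ... | yes _ = y
      ... | no  _ = u + fun b (y ∸ u)

      glueF-low : ∀ {y} → y < u → glueF y ≡ y
      glueF-low {y} y<u with y <? u
      ... | yes _  = refl
      ... | no y≮u = contradiction y<u y≮u

      glueF-high : ∀ y → glueF (u + y) ≡ u + fun b y
      glueF-high y with u + y <? u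
      ... | yes lt = contradiction lt (m+n≮m u y)
      ... | no  _  = cong (λ z → u + fun b z) (m+n∸m≡n u y)

      glueF-injective : ∀ {y z} → glueF y ≡ glueF z → y ≡ z
      glueF-injective {y} {z} e with y <? u | z <? u
      ... | yes _   | yes _   = e
      ... | yes y<u | no _    = contradiction (<-≤-trans y<u (m≤m+n u _)) (<-irrefl e)
      ... | no _    | yes z<u = contradiction (<-≤-trans z<u (m≤m+n u _)) (<-irrefl (sym e))
      ... | no y≮u  | no z≮u  = ∸-cancelʳ-≡ (≮⇒≥ y≮u) (≮⇒≥ z≮u) (injective b (+-cancelˡ-≡ u _ _ e))

      glueF-< : ∀ {y} → y < N → glueF y < N
      glueF-< {y} y<N with y <? u
      ... | yes _   = y<N
      ... | no  y≮u = <-≤-trans (+-monoʳ-< u (bounded b (∸-monoˡ-< y<N (≮⇒≥ y≮u)))) (≤-reflexive (m+[n∸m]≡n u≤N))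

    glue : Arrangement N
    glue = record { fun = fun a ∘ glueF ; injective = λ e → glueF-injective (injective a e) ; bounded = λ l → bounded a (glueF-< l) }

    glue-low : ∀ {y} → y < u → fun glue y ≡ fun a y
    glue-low y<u = cong (fun a) (glueF-low y<u)

    glue-high : ∀ y → fun glue (u + y) ≡ fun a (u + fun b y)
    glue-high y = cong (fun a) (glueF-high y)

  -- Building constant runs block by block

  bit : Bool → Fin 2
  bit false = Fin.zero
  bit true  = Fin.suc Fin.zero

  bit-injective : ∀ {x y} → bit x ≡ bit y → x ≡ y
  bit-injective {false} {false} _ = refl
  bit-injective {true}  {true}  _ = refl

  -- Only the window property of col is used: the colour of position t + R is
  -- determined by the identifiers in positions t, …, t + 2R.
  module Arrange (P : ℕ) .{{_ : NonZero P}} (R L₀ : ℕ)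
    (col : (Fin P → Fin P) → Bool → Fin P → Bool)
    (window : ∀ {π π′} → (∀ i j → π i ≡ π j → i ≡ j) → (∀ i j → π′ i ≡ π′ j → i ≡ j) → ∀ t t′ →
      (∀ i → i ≤ R + R → π ((t + i) mod P) ≡ π′ ((t′ + i) mod P)) →
      ∀ x → col π x ((t + R) mod P) ≡ col π′ x ((t′ + R) mod P))
    where

    -- A tuple of length j₀ + 1 = 2R + L contains L windows of length 2R + 1. The shift argument
    -- returns one entry more, B in all, hence L + 1 windows; B is the length of a block.
    L j₀ B : ℕ
    L = suc L₀
    j₀ = R + R + L₀
    B = suc (suc j₀)

    toFin : (ℕ → ℕ) → Fin P → Fin P
    toFin f p = f (toℕ p) mod P

    hat : Arrangement P → Fin P → Fin P
    hat a = toFin (fun a)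

    toℕ-mod-< : ∀ {m} → m < P → toℕ (m mod P) ≡ m
    toℕ-mod-< {m} lt = trans (toℕ-fromℕ< (m%n<n m P)) (m<n⇒m%n≡m lt)

    hat-injective : ∀ a i j → hat a i ≡ hat a j → i ≡ j
    hat-injective a i j e = toℕ-injective (injective a (begin
      fun a (toℕ i)  ≡⟨ sym (toℕ-mod-< (bounded a (toℕ<n i))) ⟩
      toℕ (hat a i)  ≡⟨ cong toℕ e ⟩
      toℕ (hat a j)  ≡⟨ toℕ-mod-< (bounded a (toℕ<n j)) ⟩
      fun a (toℕ j)  ∎))
      where open ≡-Reasoning

    hat-mod : ∀ a {m} → m < P → hat a (m mod P) ≡ fun a m mod P
    hat-mod a lt = cong (λ m → fun a m mod P) (toℕ-mod-< lt)

    colN : Arrangement P → Bool → ℕ → Bool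
    colN a x m = col (hat a) x (m mod P)

    colN-window : ∀ a a′ t t′ → t + (R + R) < P → t′ + (R + R) < P →
      (∀ i → i ≤ R + R → fun a (t + i) ≡ fun a′ (t′ + i)) → ∀ x → colN a x (t + R) ≡ colN a′ x (t′ + R)
    colN-window a a′ t t′ lt lt′ ag = window (hat-injective a) (hat-injective a′) t t′ λ i i≤ →
      trans (hat-mod a (≤-<-trans (+-monoʳ-≤ t i≤) lt))
        (trans (cong (_mod P) (ag i i≤)) (sym (hat-mod a′ (≤-<-trans (+-monoʳ-≤ t′ i≤) lt′))))

    -- The output as a function of the window contents alone: the window is placed at positions 0,
    -- 1, ... and read off at R. The shift argument needs a total colouring, so this is defined for
    -- every list; it has its meaning for the lists covered by `colN-colL`.
    colL : List ℕ → Bool → Bool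
    colL ws x = col (toFin (place 0 ws)) x (R mod P)

    colN-colL : ∀ a ws t → AllPairs _≢_ ws → All (_< P) ws → length ws ≤ P → R + R < length ws → t + (R + R) < P →
      (∀ i → i ≤ R + R → fun a (t + i) ≡ nth ws i) → ∀ x → colN a x (t + R) ≡ colL ws x
    colN-colL a ws t dis bnd len long lt ag = colN-window a (placeA ws bnd len) t 0 lt (<-≤-trans long len)
      λ i i≤ → trans (ag i i≤) (sym (place-nth 0 ws dis i (≤-<-trans i≤ long)))

    colour : List ℕ → Fin 4
    colour ws = combine (bit (colL ws false)) (bit (colL ws true))

    colour-colL : ∀ ws ws′ → colour ws ≡ colour ws′ → ∀ x → colL ws x ≡ colL ws′ x
    colour-colL ws ws′ e false = bit-injective (proj₁ (combine-injective (bit (colL ws false)) (bit (colL ws true)) (bit (colL ws′ false)) (bit (colL ws′ true)) e))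
    colour-colL ws ws′ e true  = bit-injective (proj₂ (combine-injective (bit (colL ws false)) (bit (colL ws true)) (bit (colL ws′ false)) (bit (colL ws′ true)) e))

    Run : Arrangement P → ℕ → Set
    Run a b = ∀ i → i < L → ∀ x → colN a x (b * B + i + R) ≡ colN a x (b * B + suc i + R)

    -- Each window has one output bit per track, so 4 colours, and a tuple has a vector of L such
    -- colours.
    threshold : ℕ
    threshold = tw j₀ (4 ^ L)

    module Step (a : Arrangement P) (q : ℕ) (room : suc q * B ≤ P) (many : threshold < P ∸ q * B) where

      u M : ℕ
      u = q * B
      M = P ∸ u

      e : Fin M → ℕ
      e i = fun a (u + toℕ i)

      -- A tuple is coloured by its L consecutive window colours: if a shift by one
      -- does not change this vector, then all the window colours agree.
      g : List (Fin M) → Fin (4 ^ L)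
      g v = funToFin (λ (i : Fin L) → colour (drop (toℕ i) (map e v)))

      u≤P : u ≤ P
      u≤P = ≤-trans (m≤n+m u B) room

      found = shift-monochromatic j₀ g many
      xs = proj₁ found
      xs-length : length xs ≡ B
      xs-length = proj₁ (proj₂ found)
      xs-asc = proj₁ (proj₂ (proj₂ found))
      xs-mono : g (front xs) ≡ g (drop 1 xs)
      xs-mono = proj₂ (proj₂ (proj₂ found))

      ys zs : List ℕ
      ys = map toℕ xs
      zs = map e xs

      ys-distinct : AllPairs _≢_ ys
      ys-distinct = AllPairsₚ.map⁺ (AllPairs.map <⇒≢ xs-asc)

      ys-bounded : All (_< M) ys
      ys-bounded = Allₚ.map⁺ (All.universal toℕ<n xs)

      zs-distinct : AllPairs _≢_ zs
      zs-distinct = AllPairsₚ.map⁺ (AllPairs.map (λ lt eq → <⇒≢ lt (+-cancelˡ-≡ u _ _ (injective a eq))) xs-asc)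

      zs-bounded : All (_< P) zs
      zs-bounded = Allₚ.map⁺ (All.universal (λ i → bounded a (<-≤-trans (+-monoʳ-< u (toℕ<n i)) (≤-reflexive (m+[n∸m]≡n u≤P)))) xs)

      zs-length : length zs ≡ B
      zs-length = trans (length-map e xs) xs-length

      ys-length : length ys ≡ B
      ys-length = trans (length-map toℕ xs) xs-length

      B≤M : B ≤ M
      B≤M = m+n≤o⇒m≤o∸n B room

      b : Arrangement M
      b = placeA ys ys-bounded (≤-trans (≤-reflexive ys-length) B≤M)

      a′ : Arrangement P
      a′ = glue a u b u≤P

      a′-high : ∀ i → i < B → fun a′ (u + i) ≡ nth zs i
      a′-high i i<B = begin
        fun a′ (u + i)             ≡⟨ glue-high a u b u≤P i ⟩
        fun a (u + place 0 ys i)   ≡⟨ cong (λ z → fun a (u + z)) (place-nth 0 ys ys-distinct i (<-≤-trans i<B (≤-reflexive (sym ys-length)))) ⟩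
        fun a (u + nth ys i)       ≡⟨ sym (nth-map-toℕ (λ z → fun a (u + z)) xs i (<-≤-trans i<B (≤-reflexive (sym xs-length)))) ⟩
        nth zs i                   ∎
        where open ≡-Reasoning

      colours-shift : ∀ i → i < L → colour (drop i (front zs)) ≡ colour (drop (suc i) zs)
      colours-shift i i<L = begin
        colour (drop i (front zs))                 ≡⟨ cong (colour ∘ drop i) (sym (map-front e xs)) ⟩
        colour (drop i (map e (front xs)))         ≡⟨ cong (λ z → colour (drop z (map e (front xs)))) (sym (toℕ-fromℕ< i<L)) ⟩
        entry (front xs) (fromℕ< i<L)              ≡⟨ sym (finToFun-funToFin (entry (front xs)) (fromℕ< i<L)) ⟩
        finToFun (g (front xs)) (fromℕ< i<L)       ≡⟨ cong (λ z → finToFun z (fromℕ< i<L)) xs-mono ⟩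
        finToFun (g (drop 1 xs)) (fromℕ< i<L)      ≡⟨ finToFun-funToFin (entry (drop 1 xs)) (fromℕ< i<L) ⟩
        entry (drop 1 xs) (fromℕ< i<L)             ≡⟨ cong (λ z → colour (drop z (map e (drop 1 xs)))) (toℕ-fromℕ< i<L) ⟩
        colour (drop i (map e (drop 1 xs)))        ≡⟨ cong (colour ∘ drop i) (map-drop1 e xs) ⟩
        colour (drop i (drop 1 zs))                ≡⟨ cong colour (drop-drop1 i zs) ⟩
        colour (drop (suc i) zs)                   ∎
        where
        open ≡-Reasoning
        entry : List (Fin M) → Fin L → Fin 4
        entry v i = colour (drop (toℕ i) (map e v))

      fits : ∀ {i} → i ≤ L → i + (R + R) < B
      fits {i} i≤L = s≤s (begin
        i + (R + R)       ≤⟨ +-monoˡ-≤ (R + R) i≤L ⟩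
        L + (R + R)       ≡⟨ +-comm L (R + R) ⟩
        R + R + suc L₀    ≡⟨ +-suc (R + R) L₀ ⟩
        suc j₀            ∎)
        where open ≤-Reasoning

      u+B≤P : u + B ≤ P
      u+B≤P = ≤-trans (≤-reflexive (+-comm u B)) room

      fitsP : ∀ {i} → i ≤ L → u + i + (R + R) < P
      fitsP {i} i≤L = <-≤-trans (≤-<-trans (≤-reflexive (+-assoc u i (R + R))) (+-monoʳ-< u (fits i≤L))) u+B≤P

      B≤P : B ≤ P
      B≤P = ≤-trans (m≤n+m B u) u+B≤P

      new-run : Run a′ q
      new-run i i<L x = begin
        colN a′ x (u + i + R)        ≡⟨ colN-colL a′ (drop i (front zs)) (u + i)
          (AllPairsₚ.drop⁺ i (AllPairs-front zs-distinct)) (Allₚ.drop⁺ i (All-front zs-bounded))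
          len₁ long₁ (fitsP (<⇒≤ i<L)) ag₁ x ⟩
        colL (drop i (front zs)) x   ≡⟨ colour-colL (drop i (front zs)) (drop (suc i) zs) (colours-shift i i<L) x ⟩
        colL (drop (suc i) zs) x     ≡⟨ sym (colN-colL a′ (drop (suc i) zs) (u + suc i)
          (AllPairsₚ.drop⁺ (suc i) zs-distinct) (Allₚ.drop⁺ (suc i) zs-bounded)
          len₂ long₂ (fitsP i<L) ag₂ x) ⟩
        colN a′ x (u + suc i + R)    ∎
        where
        open ≡-Reasoning
        l₁ : length (drop i (front zs)) ≡ suc j₀ ∸ i
        l₁ = trans (length-drop i (front zs)) (cong (_∸ i) (trans (length-front zs) (cong pred zs-length)))
        l₂ : length (drop (suc i) zs) ≡ B ∸ suc i
        l₂ = trans (length-drop (suc i) zs) (cong (_∸ suc i) zs-length)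
        long₂ : R + R < length (drop (suc i) zs)
        long₂ = <-≤-trans (m+n≤o⇒m≤o∸n (suc (R + R)) (≤-trans (≤-reflexive (cong suc (+-comm (R + R) (suc i)))) (fits i<L))) (≤-reflexive (sym l₂))
        long₁ : R + R < length (drop i (front zs))
        long₁ = <-≤-trans long₂ (≤-reflexive (trans l₂ (sym l₁)))
        len₂ : length (drop (suc i) zs) ≤ P
        len₂ = ≤-trans (≤-reflexive l₂) (≤-trans (m∸n≤m B (suc i)) B≤P)
        len₁ : length (drop i (front zs)) ≤ P
        len₁ = ≤-trans (≤-reflexive (trans l₁ (sym l₂))) len₂
        ag₁ : ∀ k → k ≤ R + R → fun a′ (u + i + k) ≡ nth (drop i (front zs)) k
        ag₁ k k≤ = trans (cong (fun a′) (+-assoc u i k)) (trans (a′-high (i + k) (<⇒≤ lt))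
          (trans (sym (nth-front zs (i + k) (<-≤-trans lt (≤-reflexive (sym zs-length))))) (sym (nth-drop i (front zs) k))))
          where
          lt : suc i + k < B
          lt = ≤-<-trans (+-monoʳ-≤ (suc i) k≤) (fits i<L)
        ag₂ : ∀ k → k ≤ R + R → fun a′ (u + suc i + k) ≡ nth (drop (suc i) zs) k
        ag₂ k k≤ = trans (cong (fun a′) (+-assoc u (suc i) k)) (trans (a′-high (suc i + k) (≤-<-trans (+-monoʳ-≤ (suc i) k≤) (fits i<L))) (sym (nth-drop (suc i) zs k)))

      -- The windows of an earlier block end before position u, where the new arrangement still
      -- agrees with the old one. Later blocks therefore never spoil earlier runs.
      unchanged : ∀ c i → c < q → i ≤ L → ∀ x → colN a′ x (c * B + i + R) ≡ colN a x (c * B + i + R)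
      unchanged c i c<q i≤L = colN-window a′ a (c * B + i) (c * B + i) inP inP
        λ k k≤ → glue-low a u b u≤P (≤-<-trans (+-monoʳ-≤ (c * B + i) k≤) inU)
        where
        inU : c * B + i + (R + R) < u
        inU = <-≤-trans (≤-<-trans (≤-reflexive (+-assoc (c * B) i (R + R))) (+-monoʳ-< (c * B) (fits i≤L)))
                (≤-trans (≤-reflexive (+-comm (c * B) B)) (*-monoˡ-≤ B c<q))
        inP : c * B + i + (R + R) < P
        inP = <-≤-trans inU u≤P

      old-run : ∀ c → c < q → Run a c → Run a′ c
      old-run c c<q run i i<L x = trans (unchanged c i c<q (<⇒≤ i<L) x) (trans (run i i<L x) (sym (unchanged c (suc i) c<q i<L x)))

    runs : ∀ q → q * B + threshold < P → Σ (Arrangement P) λ a → ∀ c → c < q → Run a c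
    runs zero    _ = identity P , λ _ ()
    runs (suc q) h with runs q (≤-<-trans (+-monoˡ-≤ threshold (m≤n+m (q * B) B)) h)
    ... | a , old = a′ , all-runs
      where
      open Step a q (≤-trans (m≤m+n (suc q * B) threshold) (<⇒≤ h))
        (m+n≤o⇒m≤o∸n (suc threshold) (≤-trans (s≤s (≤-trans (+-monoʳ-≤ threshold (m≤n+m (q * B) B)) (≤-reflexive (+-comm threshold (suc q * B))))) h))
      all-runs : ∀ c → c < suc q → Run a′ c
      all-runs c (s≤s c≤q) with m≤n⇒m<n∨m≡n c≤q
      ... | inj₁ c<q  = old-run c c<q (old c c<q)
      ... | inj₂ refl = new-run

  -- Size of the cut

  sumN : ℕ → (ℕ → ℕ) → ℕ
  sumN n F = sumFin n (λ i → F (toℕ i))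

  sumN-+ : ∀ a b F → sumN (a + b) F ≡ sumN a F + sumN b (λ i → F (a + i))
  sumN-+ a b F = trans (sumFin-↑ a b _) (cong₂ _+_ (sumFin-cong a (λ i → cong F (toℕ-↑ˡ i b))) (sumFin-cong b (λ i → cong F (toℕ-↑ʳ a i))))

  sumN-≤ : ∀ n F {c} → (∀ i → i < n → F i ≤ c) → sumN n F ≤ n * c
  sumN-≤ n F {c} h = ≤-trans (sumFin-mono n (λ i → h (toℕ i) (toℕ<n i))) (≤-reflexive (sumFin-const n c))

  sumN-blocks : ∀ q B F {c} → (∀ b → b < q → sumN B (λ i → F (b * B + i)) ≤ c) → sumN (q * B) F ≤ q * c
  sumN-blocks zero    B F     h = z≤n
  sumN-blocks (suc q) B F {c} h = begin
    sumN (B + q * B) F                           ≡⟨ sumN-+ B (q * B) F ⟩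
    sumN B F + sumN (q * B) (λ i → F (B + i))    ≤⟨ +-mono-≤ (h 0 (s≤s z≤n)) (sumN-blocks q B (λ i → F (B + i)) λ b b<q →
        ≤-trans (≤-reflexive (sumFin-cong B (λ i → cong F (sym (+-assoc B (b * B) (toℕ i)))))) (h (suc b) (s≤s b<q))) ⟩
    c + q * c                                    ∎
    where open ≤-Reasoning

  -- A block consists of R positions before the good ones, 2 + Y good ones, and R + D after them.
  -- Every position is charged c, and only the others and the rest are charged w on top.
  sumN-runs : ∀ q R Y D rest F {c w} → (∀ i → F i ≤ c + w) →
    (∀ b i → b < q → i < 2 + Y → F (b * (R + (2 + Y + (R + D))) + (R + i)) ≤ c) →
    sumN (q * (R + (2 + Y + (R + D))) + rest) F ≤ (q * (R + (2 + Y + (R + D))) + rest) * c + (q * (R + R + D) + rest) * w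
  sumN-runs q R Y D rest F {c} {w} crude good = begin
    sumN (q * B + rest) F                                     ≡⟨ sumN-+ (q * B) rest F ⟩
    sumN (q * B) F + sumN rest (λ i → F (q * B + i))          ≤⟨ +-mono-≤ (sumN-blocks q B F blk) (sumN-≤ rest (λ i → F (q * B + i)) (λ i _ → crude (q * B + i))) ⟩
    q * (R * (c + w) + ((2 + Y) * c + (R + D) * (c + w))) + rest * (c + w) ≡⟨ arith q R Y D rest c w ⟩
    (q * B + rest) * c + (q * (R + R + D) + rest) * w         ∎
    where
    open ≤-Reasoning
    B = R + (2 + Y + (R + D))
    arith : ∀ q R Y D rest c w → q * (R * (c + w) + ((2 + Y) * c + (R + D) * (c + w))) + rest * (c + w)
      ≡ (q * (R + (2 + Y + (R + D))) + rest) * c + (q * (R + R + D) + rest) * w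
    arith = solve-∀
    blk : ∀ b → b < q → sumN B (λ i → F (b * B + i)) ≤ R * (c + w) + ((2 + Y) * c + (R + D) * (c + w))
    blk b b<q = begin
      sumN B F₁                                                      ≡⟨ sumN-+ R (2 + Y + (R + D)) F₁ ⟩
      sumN R F₁ + sumN (2 + Y + (R + D)) (λ i → F₁ (R + i))          ≡⟨ cong (sumN R F₁ +_) (sumN-+ (2 + Y) (R + D) (λ i → F₁ (R + i))) ⟩
      sumN R F₁ + (sumN (2 + Y) (λ i → F₁ (R + i)) + sumN (R + D) (λ i → F₁ (R + (2 + Y + i))))
        ≤⟨ +-mono-≤ (sumN-≤ R F₁ (λ i _ → crude _))
             (+-mono-≤ (sumN-≤ (2 + Y) (λ i → F₁ (R + i)) (λ i lt → good b i b<q lt))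
                       (sumN-≤ (R + D) (λ i → F₁ (R + (2 + Y + i))) (λ i _ → crude _))) ⟩
      R * (c + w) + ((2 + Y) * c + (R + D) * (c + w))                ∎
      where
      F₁ : ℕ → ℕ
      F₁ i = F (b * B + i)

  T-∧₁ : ∀ {a b} → T (a ∧ b) → T a
  T-∧₁ t = proj₁ (Equivalence.to T-∧ t)

  module CutBound
    (P : ℕ) .{{_ : NonZero P}} (s : ℕ) (2D≤P : s * 2 * 2 ≤ P) (evenP : odd P ≡ false)
    (flag : Bool) (J : ℕ) (junk : OGraph J) (junkClass : InClass (s * 2 + ind flag) junk)
    where

    open Instance P s 2D≤P evenP flag J junk junkClass
    private
      module L = Block cyc match cyc
      module GB = Block ladder (λ _ _ → false) junk

    module _ (S : Cut n) where

      leaves : Fin n → Fin n → Bool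
      leaves u v = arc G u v ∧ (not (S u) ∧ S v)

      outcut : Fin n → ℕ
      outcut u = countFin n (leaves u)

      outcut≤d : ∀ u → outcut u ≤ d
      outcut≤d u = ≤-trans (countFin-mono n (λ v t → Equivalence.from (T-∨ {arc G v u}) (inj₂ (T-∧₁ {arc G u v} t)))) (≤-reflexive (proj₁ G-class u))

      posCut : Fin P → ℕ
      posCut p = outcut (vtx false p) + outcut (vtx true p)

      -- Each arc is charged to its tail, so only outgoing jumps matter, and these lead forward.
      -- Hence a run loses D positions at its upper end only.
      Steady : Fin P → Set
      Steady p = ∀ x p′ → T (jumpArc p p′) → S (vtx x p) ≡ S (vtx x p′)

      same-side : ∀ x p → Steady p → ∀ p′ → (jumpArc p p′ ∧ (not (S (vtx x p)) ∧ S (vtx x p′))) ≡ false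
      same-side x p st p′ with jumpArc p p′ | st x p′
      ... | false | _ = refl
      ... | true  | e = trans (cong (λ b → not b ∧ S (vtx x p′)) (e tt)) (∧-inverseˡ (S (vtx x p′)))

      outcut-split : ∀ x p → outcut (vtx x p) ≡
        countFin P (λ p′ → leaves (vtx x p) (vtx false p′)) + countFin P (λ p′ → leaves (vtx x p) (vtx true p′))
      outcut-split x p = begin
        outcut (vtx x p)
          ≡⟨ countFin-↑ (P + P) J _ ⟩
        countFin (P + P) (λ v → leaves (vtx x p) (v ↑ˡ J)) + countFin J (λ j → leaves (vtx x p) (P + P ↑ʳ j))
          ≡⟨ cong₂ _+_ (countFin-↑ P P _) (countFin-false J (λ j → cong (_∧ (not (S (vtx x p)) ∧ S (P + P ↑ʳ j))) (GB.arc-lr (track x p) j))) ⟩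
        countFin P (λ p′ → leaves (vtx x p) (vtx false p′)) + countFin P (λ p′ → leaves (vtx x p) (vtx true p′)) + 0
          ≡⟨ +-identityʳ _ ⟩
        countFin P (λ p′ → leaves (vtx x p) (vtx false p′)) + countFin P (λ p′ → leaves (vtx x p) (vtx true p′))
          ∎
        where open ≡-Reasoning

      arc-same : ∀ x p p′ → arc G (vtx x p) (vtx x p′) ≡ jumpArc p p′
      arc-same false p p′ = trans (GB.arc-ll _ _) (L.arc-ll p p′)
      arc-same true  p p′ = trans (GB.arc-ll _ _) (L.arc-rr p p′)

      count-same : ∀ x p → Steady p → countFin P (λ p′ → leaves (vtx x p) (vtx x p′)) ≡ 0
      count-same x p st = countFin-false P (λ p′ → trans (cong (_∧ (not (S (vtx x p)) ∧ S (vtx x p′))) (arc-same x p p′)) (same-side x p st p′))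

      -- At a steady position only the matching arc can be cut.
      posCut-steady : ∀ p → Steady p → posCut p ≤ ind flag
      posCut-steady p st = begin
        posCut p            ≡⟨ cong₂ _+_ (trans (outcut-split false p) (cong (_+ out₁) (count-same false p st)))
                                        (trans (outcut-split true p) (cong₂ _+_ none (count-same true p st))) ⟩
        out₁ + 0            ≡⟨ +-identityʳ out₁ ⟩
        out₁                ≤⟨ countFin-mono P (λ p′ t → subst T (trans (GB.arc-ll _ _) (L.arc-lr p p′)) (T-∧₁ {arc G (vtx false p) (vtx true p′)} t)) ⟩
        countFin P (match p) ≡⟨ countFin-match p ⟩
        ind flag            ∎
        where
        open ≤-Reasoning
        out₁ = countFin P (λ p′ → leaves (vtx false p) (vtx true p′))
        none : countFin P (λ p′ → leaves (vtx true p) (vtx false p′)) ≡ 0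
        none = countFin-false P (λ p′ → cong (_∧ (not (S (vtx true p)) ∧ S (vtx false p′))) (trans (GB.arc-ll _ _) (L.arc-rl p′ p)))

      cutSize-≤ : cutSize G S ≤ sumFin P posCut + J * d
      cutSize-≤ = begin
        cutSize G S                                                  ≡⟨ sumFin-↑ (P + P) J outcut ⟩
        sumFin (P + P) (λ u → outcut (u ↑ˡ J)) + sumFin J (λ j → outcut (P + P ↑ʳ j))
          ≤⟨ +-mono-≤ (≤-reflexive (trans (sumFin-↑ P P _) (sym (sumFin-+ P _ _)))) (sumFin-mono J (λ j → outcut≤d (P + P ↑ʳ j))) ⟩
        sumFin P posCut + sumFin J (λ _ → d)                         ≡⟨ cong (sumFin P posCut +_) (sumFin-const J d) ⟩
        sumFin P posCut + J * d                                      ∎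
        where open ≤-Reasoning

      cutSize-runs : ∀ q R Y rest → P ≡ q * (R + (2 + Y + (R + D))) + rest →
        (∀ b i → b < q → i < 2 + Y → Steady ((b * (R + (2 + Y + (R + D))) + (R + i)) mod P)) →
        cutSize G S ≤ P * ind flag + (q * (R + R + D) + rest) * (d + d) + J * d
      cutSize-runs q R Y rest Peq st = ≤-trans cutSize-≤ (+-monoˡ-≤ (J * d) (begin
        sumFin P posCut                          ≡⟨ sumFin-cong P (λ p → cong posCut (sym (toℕ-mod-id p))) ⟩
        sumN P F                                 ≡⟨ cong (λ N → sumN N F) Peq ⟩
        sumN (q * (R + (2 + Y + (R + D))) + rest) F
          ≤⟨ sumN-runs q R Y D rest F (λ i → ≤-trans (+-mono-≤ (outcut≤d (vtx false (i mod P))) (outcut≤d (vtx true (i mod P)))) (m≤n+m (d + d) (ind flag)))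
               (λ b i b<q lt → posCut-steady _ (st b i b<q lt)) ⟩
        (q * (R + (2 + Y + (R + D))) + rest) * ind flag + (q * (R + R + D) + rest) * (d + d)
          ≡⟨ cong (λ N → N * ind flag + (q * (R + R + D) + rest) * (d + d)) (sym Peq) ⟩
        P * ind flag + (q * (R + R + D) + rest) * (d + d) ∎))
        where
        open ≤-Reasoning
        F : ℕ → ℕ
        F m = posCut (m mod P)

  -- Bounding the number of vertices

  -- The hypothesis is applied to both orientations of the bipartition, which together cut all nd/2
  -- arcs. Adding the two avoids deciding which one is larger.
  approx⇒linear : ∀ {n d} .{{_ : NonZero d}} c e (G : OGraph n) → InClass d G → (S : Cut n) →
    (∀ S′ → c * cutSize G S′ ≤ d * e * cutSize G S) → c * n ≤ 4 * e * cutSize G S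
  approx⇒linear {n} {d} c e G (reg , χ , bip) S W = *-cancelʳ-≤ _ _ d (begin
    c * n * d                                ≡⟨ *-assoc c n d ⟩
    c * (n * d)                              ≡⟨ cong (c *_) (handshake G reg) ⟩
    c * (arcs G + arcs G)                    ≡⟨ *-distribˡ-+ c (arcs G) (arcs G) ⟩
    c * arcs G + c * arcs G                  ≤⟨ +-mono-≤ half half ⟩
    d * e * x + d * e * x + (d * e * x + d * e * x) ≡⟨ ring d e x ⟩
    4 * e * x * d                            ∎)
    where
    open ≤-Reasoning
    x = cutSize G S
    ring : ∀ d e x → d * e * x + d * e * x + (d * e * x + d * e * x) ≡ 4 * e * x * d
    ring = solve-∀
    half : c * arcs G ≤ d * e * x + d * e * x
    half = begin
      c * arcs G                                              ≡⟨ cong (c *_) (sym (cut-bipartition G χ bip)) ⟩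
      c * (cutSize G χ + cutSize G (λ v → not (χ v)))         ≡⟨ *-distribˡ-+ c (cutSize G χ) _ ⟩
      c * cutSize G χ + c * cutSize G (λ v → not (χ v))       ≤⟨ +-mono-≤ (W χ) (W (λ v → not (χ v))) ⟩
      d * e * x + d * e * x                                   ∎

  +≤tw : ∀ j c → j + c ≤ tw j c
  +≤tw zero    c = ≤-refl
  +≤tw (suc j) c = ≤-trans (≤-trans (≤-reflexive (sym (+-suc j c))) (+-monoʳ-≤ j (n<2^n c))) (+≤tw j (2 ^ c))

  -- E is the denominator of ε; Y makes the 2R + D unsteady positions of a block of
  -- length B a fraction at most 1/(8E) of it, and more than th unused identifiers yield a block.
  module Parameters (s : ℕ) (flag : Bool) (E : ℕ) (r : ℕ) where

    d D R Y L₀ j₀ th : ℕ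
    D = s * 2
    d = D + ind flag
    R = r * D
    Y = 8 * E * (R + R + D)
    L₀ = Y + D
    j₀ = R + R + L₀
    th = tw j₀ (4 ^ suc L₀)

    -- The fraction `ratio` / (dE) is 2f/d + 1/E, the guarantee with ε weakened to 1/E.
    ratio : ℕ
    ratio = 2 * ind flag * E + d

    Approximates : ∀ {k n} → LocalAlg k n r → Set
    Approximates {k} {n} A = ∀ (G : OGraph n) id → InClass d G → ValidIds k n id →
      ∀ S′ → ratio * cutSize G S′ ≤ d * E * cutSize G (out A G id)

    j₀<th : j₀ < th
    j₀<th = ≤-trans (≤-trans (≤-reflexive (+-comm 1 j₀)) (+-monoʳ-≤ j₀ (m^n>0 4 (suc L₀)))) (+≤tw j₀ (4 ^ suc L₀))

    module Large .{{_ : NonZero E}} .{{_ : NonZero d}} {k} (k≥1 : 1 ≤ k)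
      (P : ℕ) (th<P : th < P) (evenP : odd P ≡ false)
      (J : ℕ) (junk : OGraph J) (junkClass : InClass d junk)
      (A : LocalAlg k (P + P + J) r) (approx : Approximates A)
      where

      instance
        P≢0 : NonZero P
        P≢0 = >-nonZero (≤-trans (s≤s z≤n) th<P)

      j₀<P : j₀ < P
      j₀<P = <-trans j₀<th th<P

      D≤Y : R + R + D ≤ Y
      D≤Y = m≤n*m (R + R + D) (8 * E) {{m*n≢0 8 E}}

      2D≤P : s * 2 * 2 ≤ P
      2D≤P = ≤-trans (≤-reflexive (sym (m+m≡m*2 D))) (≤-trans (+-monoˡ-≤ D (≤-trans (m≤n+m D (R + R)) D≤Y)) (≤-trans (m≤n+m L₀ (R + R)) (<⇒≤ j₀<P)))

      2R+D≤P : R + R + D ≤ P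
      2R+D≤P = ≤-trans (+-monoʳ-≤ (R + R) (m≤n+m D Y)) (<⇒≤ j₀<P)

      R<P : R < P
      R<P = ≤-<-trans (≤-trans (m≤m+n R R) (m≤m+n (R + R) L₀)) j₀<P

      open Instance P s 2D≤P evenP flag J junk junkClass using (G; G-class; ids; ids-valid; vtx; jumpArc; jump-range; toℕ-mod; toℕ-mod-id; module Radius)
      open Radius r 2R+D≤P R<P using (module Colours)
      open Colours k≥1 A using (col; col-window)
      open Arrange P R L₀ col col-window using (B; hat; hat-injective; colN; Run; runs)
      open CutBound P s 2D≤P evenP flag J junk junkClass using (Steady; cutSize-runs)

      B′ : ℕ
      B′ = R + (2 + Y + (R + D))

      B≡B′ : B ≡ B′
      B≡B′ = ring R Y D
        where
        ring : ∀ R Y D → suc (suc (R + R + (Y + D))) ≡ R + (2 + Y + (R + D))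
        ring = solve-∀

      -- th + 1 positions are set aside before dividing into blocks, so that more than `th`
      -- identifiers are still available when the last block is carved out.
      P₀ q rest : ℕ
      P₀ = P ∸ suc th
      q = P₀ / B
      rest = suc th + P₀ % B

      P≡ : P ≡ q * B + rest
      P≡ = begin
        P                              ≡⟨ sym (m+[n∸m]≡n th<P) ⟩
        suc th + P₀                    ≡⟨ cong (suc th +_) (m≡m%n+[m/n]*n P₀ B) ⟩
        suc th + (P₀ % B + q * B)      ≡⟨ sym (+-assoc (suc th) (P₀ % B) (q * B)) ⟩
        rest + q * B                   ≡⟨ +-comm rest (q * B) ⟩
        q * B + rest                   ∎
        where open ≡-Reasoning

      rest≤ : rest ≤ suc th + suc th
      rest≤ = +-monoʳ-≤ (suc th) (≤-trans (<⇒≤ (m%n<n P₀ B)) (s≤s j₀<th))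

      qB+th<P : q * B + th < P
      qB+th<P = ≤-trans (≤-trans (≤-reflexive (sym (+-suc (q * B) th))) (+-monoʳ-≤ (q * B) (m≤m+n (suc th) _))) (≤-reflexive (sym P≡))

      a = proj₁ (runs q qB+th<P)
      S : Cut (P + P + J)
      S = out A G (ids (hat a))

      run-constant : ∀ b → b < q → ∀ i e → i + e ≤ suc L₀ → ∀ x → colN a x (b * B + i + R) ≡ colN a x (b * B + (i + e) + R)
      run-constant b b<q i zero    h x = cong (λ z → colN a x (b * B + z + R)) (sym (+-identityʳ i))
      run-constant b b<q i (suc e) h x = trans (run-constant b b<q i e (<⇒≤ h′) x)
        (trans (proj₂ (runs q qB+th<P) b b<q (i + e) h′ x) (cong (λ z → colN a x (b * B + z + R)) (sym (+-suc i e))))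
        where
        h′ : i + e < suc L₀
        h′ = ≤-trans (≤-reflexive (sym (+-suc i e))) h

      -- A jump from the good position with index i advances by some e < D. Since i + e ≤ L it stays
      -- inside the run of L + 1 equal outputs, and m + D < P keeps it from wrapping around.
      steady : ∀ b i → b < q → i < 2 + Y → Steady S ((b * B′ + (R + i)) mod P)
      steady b i b<q i<2+Y x p′ t = begin
        S (vtx x ((b * B′ + (R + i)) mod P))   ≡⟨ cong (λ m → S (vtx x (m mod P))) pos ⟩
        colN a x (b * B + i + R)               ≡⟨ run-constant b b<q i e i+e≤ x ⟩
        colN a x (b * B + (i + e) + R)         ≡⟨ cong (λ m → S (vtx x (m mod P))) pos′ ⟩
        S (vtx x (toℕ p′ mod P))               ≡⟨ cong (S ∘ vtx x) (toℕ-mod-id p′) ⟩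
        S (vtx x p′)                           ∎
        where
        open ≡-Reasoning
        m = b * B′ + (R + i)
        p = m mod P
        pos : m ≡ b * B + i + R
        pos = trans (cong (λ z → b * z + (R + i)) (sym B≡B′)) (trans (cong (b * B +_) (+-comm R i)) (sym (+-assoc (b * B) i R)))
        m+D<P : m + D < P
        m+D<P = ≤-trans (≤-trans (s≤s (≤-reflexive (+-assoc (b * B′) (R + i) D))) (+-monoʳ-< (b * B′) small))
          (≤-trans (≤-reflexive (trans (+-comm (b * B′) B′) (cong (suc b *_) (sym B≡B′)))) (≤-trans (*-monoˡ-≤ B b<q) (≤-trans (m≤m+n (q * B) rest) (≤-reflexive (sym P≡)))))
          where
          small : R + i + D < B′
          small = ≤-trans (s≤s (≤-reflexive (+-assoc R i D))) (+-monoʳ-< R (≤-trans (+-monoˡ-≤ D i<2+Y) (+-monoʳ-≤ (2 + Y) (m≤n+m D R))))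
        toℕp : toℕ p ≡ m
        toℕp = trans (toℕ-mod m) (m<n⇒m%n≡m (≤-<-trans (m≤m+n m D) m+D<P))
        range = jump-range p p′ t (≤-trans (≤-reflexive (cong (_+ D) toℕp)) (<⇒≤ m+D<P))
        m≤p′ : m ≤ toℕ p′
        m≤p′ = ≤-trans (≤-reflexive (sym toℕp)) (proj₁ range)
        e : ℕ
        e = toℕ p′ ∸ m
        m+e : m + e ≡ toℕ p′
        m+e = m+[n∸m]≡n m≤p′
        e<D : e < D
        e<D = +-cancelˡ-< m e D (≤-trans (s≤s (≤-reflexive m+e)) (≤-trans (proj₂ range) (≤-reflexive (cong (_+ D) toℕp))))
        i+e≤ : i + e ≤ suc L₀
        i+e≤ = ≤-pred (≤-trans (≤-reflexive (sym (+-suc i e))) (+-mono-≤ (<⇒≤ i<2+Y) e<D))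
        pos′ : b * B + (i + e) + R ≡ toℕ p′
        pos′ = trans (ring (b * B) i e R) (trans (cong (_+ e) (sym pos)) m+e)
          where
          ring : ∀ w i e R → w + (i + e) + R ≡ w + i + R + e
          ring = solve-∀

      Z : ℕ
      Z = q * (R + R + D) + rest

      cut≤ : cutSize G S ≤ P * ind flag + Z * (d + d) + J * d
      cut≤ = cutSize-runs S q R Y rest (trans P≡ (cong (λ z → q * z + rest) B≡B′)) steady

      -- The part 2f/d of the ratio is matched exactly by the matching arcs: 4EPf stands on both
      -- sides and cancels. Only the 1/E part is left, and it has to be paid for by the unsteady
      -- positions and the junk.
      n≤Z : P + P + J ≤ 4 * E * (2 * Z + J)
      n≤Z = *-cancelˡ-≤ d (≤-trans (m≤n+m (d * n) (2 * f * E * J)) (+-cancelˡ-≤ (4 * E * P * f) _ _ (begin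
        4 * E * P * f + (2 * f * E * J + d * n)              ≡⟨ ring₁ E P f J d ⟩
        ratio * n                                            ≤⟨ approx⇒linear ratio E G G-class S (approx G (ids (hat a)) G-class (ids-valid k≥1 (hat-injective a))) ⟩
        4 * E * cutSize G S                                  ≤⟨ *-monoʳ-≤ (4 * E) cut≤ ⟩
        4 * E * (P * f + Z * (d + d) + J * d)                ≡⟨ ring₂ E P f J d Z ⟩
        4 * E * P * f + d * (4 * E * (2 * Z + J))            ∎)))
        where
        open ≤-Reasoning
        n = P + P + J
        f = ind flag
        ring₁ : ∀ E P f J d → 4 * E * P * f + (2 * f * E * J + d * (P + P + J)) ≡ (2 * f * E + d) * (P + P + J)
        ring₁ = solve-∀
        ring₂ : ∀ E P f J d Z → 4 * E * (P * f + Z * (d + d) + J * d) ≡ 4 * E * P * f + d * (4 * E * (2 * Z + J))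
        ring₂ = solve-∀

      -- The unsteady positions of the q blocks contribute 8Eq(2R + D) = qY to `n≤Z`, which is at
      -- most P by the choice of `Y`. One P is absorbed in this way, and the other is bounded by
      -- `rest` and the junk.
      large : P + P + J ≤ 32 * E * suc th + (8 * E * J + J)
      large = begin
        P + P + J                                        ≤⟨ +-monoˡ-≤ J (+-mono-≤ P≤ P≤) ⟩
        X + X + J                                        ≤⟨ +-monoˡ-≤ J (+-mono-≤ X≤ X≤) ⟩
        X′ + X′ + J                                      ≡⟨ ring₃ E (suc th) J ⟩
        32 * E * suc th + (8 * E * J + J)                ∎
        where
        open ≤-Reasoning
        X = 8 * E * rest + 4 * E * J
        X′ = 8 * E * (suc th + suc th) + 4 * E * J
        X≤ : X ≤ X′
        X≤ = +-monoˡ-≤ (4 * E * J) (*-monoʳ-≤ (8 * E) rest≤)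
        ring₃ : ∀ E t J → (8 * E * (t + t) + 4 * E * J) + (8 * E * (t + t) + 4 * E * J) + J ≡ 32 * E * t + (8 * E * J + J)
        ring₃ = solve-∀
        ring₄ : ∀ E q w rest J → 4 * E * (2 * (q * w + rest) + J) ≡ q * (8 * E * w) + (8 * E * rest + 4 * E * J)
        ring₄ = solve-∀
        qY≤P : q * Y ≤ P
        qY≤P = ≤-trans (*-monoʳ-≤ q (≤-trans (m≤m+n Y D) (≤-trans (m≤n+m L₀ (R + R)) (m≤n+m j₀ 2)))) (≤-trans (m≤m+n (q * B) rest) (≤-reflexive (sym P≡)))
        P≤ : P ≤ X
        P≤ = +-cancelˡ-≤ P _ _ (begin
          P + P                              ≤⟨ m≤m+n (P + P) J ⟩
          P + P + J                          ≤⟨ n≤Z ⟩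
          4 * E * (2 * Z + J)                ≡⟨ ring₄ E q (R + R + D) rest J ⟩
          q * Y + X                          ≤⟨ +-monoˡ-≤ X qY≤P ⟩
          P + X                              ∎)

    size-bound : ℕ
    size-bound = 32 * E * suc th + (8 * E * (suc d + suc d) + (suc d + suc d))

    padded-bound : .{{_ : NonZero E}} .{{_ : NonZero d}} → ∀ {k} → 1 ≤ k → ∀ {n} P j → n ≡ P + P + (j + j) → odd P ≡ false →
      j ≤ suc d → Σ (OGraph (j + j)) (InClass d) → (A : LocalAlg k n r) → Approximates A → n ≤ size-bound
    padded-bound k≥1 P j refl evenP j≤ (junk , cl) A approx with th <? P
    ... | yes th<P = ≤-trans (Large.large k≥1 P th<P evenP (j + j) junk cl A approx)
      (+-monoʳ-≤ (32 * E * suc th) (+-mono-≤ (*-monoʳ-≤ (8 * E) (+-mono-≤ j≤ j≤)) (+-mono-≤ j≤ j≤)))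
    ... | no  th≮P = +-mono-≤ 2P≤ (≤-trans (+-mono-≤ j≤ j≤) (m≤n+m _ (8 * E * (suc d + suc d))))
      where
      P≤ : P ≤ suc th
      P≤ = ≤-trans (≮⇒≥ th≮P) (n≤1+n th)
      2P≤ : P + P ≤ 32 * E * suc th
      2P≤ = begin
        P + P                 ≤⟨ +-mono-≤ P≤ P≤ ⟩
        suc th + suc th       ≡⟨ cong (suc th +_) (sym (+-identityʳ (suc th))) ⟩
        2 * suc th            ≤⟨ *-monoˡ-≤ (suc th) (≤-trans (s≤s (s≤s z≤n)) (m≤m*n 32 E)) ⟩
        32 * E * suc th       ∎
        where open ≤-Reasoning

    -- With n = 2m, the half-size j of the junk is chosen among d and d + 1 to have the parity of m,
    -- so that P = m - j is even. If m ≤ d there is no room for junk, but then n is below the bound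
    -- anyway.
    bounded-size : .{{_ : NonZero E}} .{{_ : NonZero d}} → ∀ {k} → 1 ≤ k → ∀ {n} m → n ≡ m + m → (A : LocalAlg k n r) →
      Approximates A → n ≤ size-bound
    bounded-size {k} k≥1 {n} m n≡ A approx with suc d ≤? m
    ... | no d≮m = ≤-trans (≤-reflexive n≡) (≤-trans (+-mono-≤ m≤ m≤) (≤-trans (m≤n+m _ (8 * E * (suc d + suc d))) (m≤n+m _ (32 * E * suc th))))
      where m≤ = <⇒≤ (≰⇒> d≮m)
    ... | yes d<m = byParity (odd m Bool.≟ odd d)
      where
      withJunk : ∀ j → j ≤ m → j ≤ suc d → odd m ≡ odd j → Σ (OGraph (j + j)) (InClass d) → n ≤ size-bound
      withJunk j j≤m j≤ e junk = padded-bound k≥1 (m ∸ j) j n≡′ (xor-cancel (odd j) (odd (m ∸ j)) par) j≤ junk A approx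
        where
        m≡ : j + (m ∸ j) ≡ m
        m≡ = m+[n∸m]≡n j≤m
        n≡′ : n ≡ (m ∸ j) + (m ∸ j) + (j + j)
        n≡′ = trans n≡ (trans (cong₂ _+_ (sym m≡) (sym m≡)) (ring j (m ∸ j)))
          where
          ring : ∀ j p → j + p + (j + p) ≡ p + p + (j + j)
          ring = solve-∀
        par : odd j xor odd (m ∸ j) ≡ odd j
        par = trans (sym (odd-+ j (m ∸ j))) (trans (cong odd m≡) e)
        xor-cancel : ∀ x y → x xor y ≡ x → y ≡ false
        xor-cancel false y     e  = e
        xor-cancel true  false e  = refl
      byParity : Dec (odd m ≡ odd d) → n ≤ size-bound
      byParity (yes e) = withJunk d (<⇒≤ d<m) (n≤1+n d) e (completeBipartite d)
      byParity (no ne) = withJunk (suc d) d<m ≤-refl (¬-not ne) (crown d)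

  -- From the size bound to a linear bound on log*

  module Asymptotics (s : ℕ) (flag : Bool) (E : ℕ) where

    open Parameters s flag E using (j₀; L₀; th; j₀<th; size-bound)

    d slope : ℕ
    d = s * 2 + ind flag
    slope = 32 * E + 32 * E + (8 * E * (suc d + suc d) + (suc d + suc d))

    -- The threshold 4^L = 2^(2L) adds one level to the tower of height j₀ and leaves 2L at the top;
    -- `slope` collects the constant factors, which `*-tw` moves up there.
    height : ℕ → ℕ
    height r = suc (j₀ r) + (2 * suc (L₀ r) + slope)

    logStar-size : ∀ r n → n ≤ size-bound r → logStar n ≤ height r
    logStar-size r n h = logStarAux-tw n (suc (j₀ r)) (begin
      n                                         ≤⟨ h ⟩
      32 * E * suc t + Y′                       ≤⟨ +-mono-≤ (*-monoʳ-≤ (32 * E) (+-monoˡ-≤ t 1≤t)) (m≤m*n Y′ t {{>-nonZero 1≤t}}) ⟩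
      32 * E * (t + t) + Y′ * t                 ≡⟨ ring (32 * E) t Y′ ⟩
      slope * t                                 ≡⟨ cong (slope *_) t≡ ⟩
      slope * tw (suc (j₀ r)) (2 * suc (L₀ r))  ≤⟨ *-tw (j₀ r) (2 * suc (L₀ r)) slope ⟩
      tw (suc (j₀ r)) (2 * suc (L₀ r) + slope)  ∎)
      where
      open ≤-Reasoning
      t = th r
      Y′ = 8 * E * (suc d + suc d) + (suc d + suc d)
      1≤t : 1 ≤ t
      1≤t = ≤-trans (s≤s z≤n) (j₀<th r)
      t≡ : t ≡ tw (suc (j₀ r)) (2 * suc (L₀ r))
      t≡ = cong (tw (j₀ r)) (^-*-assoc 2 2 (suc (L₀ r)))
      ring : ∀ x t y → x * (t + t) + y * t ≡ (x + x + y) * t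
      ring = solve-∀

    height-linear : ∀ r → height (suc r) ≤ height 1 * suc r
    -- `height` is affine in r; the difference of the two sides is r times `height 0`, the summand
    -- in `ring`.
    height-linear r = ≤-trans (m≤m+n _ _) (≤-reflexive (ring r (s * 2) E slope))
      where
      ring : ∀ r D E z →
        suc (suc r * D + suc r * D + (8 * E * (suc r * D + suc r * D + D) + D)) + (2 * suc (8 * E * (suc r * D + suc r * D + D) + D) + z)
          + r * (3 + 3 * (8 * E * D + D) + z)
        ≡ (suc (1 * D + 1 * D + (8 * E * (1 * D + 1 * D + D) + D)) + (2 * suc (8 * E * (1 * D + 1 * D + D) + D) + z)) * suc r
      ring = solve-∀

    -- For r = 0 the right side is 0, so zero rounds have to be excluded outright; this is why n
    -- must exceed `size-bound 0`.
    logStar-linear : ∀ r n → suc (size-bound 0) ≤ n → n ≤ size-bound r → logStar n ≤ height 1 * r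
    logStar-linear zero    n n≥ h = contradiction (≤-trans n≥ h) (<-irrefl refl)
    logStar-linear (suc r) n n≥ h = ≤-trans (logStar-size (suc r) n h) (height-linear r)

-- Rational approximation ratios and the two parities of d

open Construction using (ind; class⇒even; module Parameters; module Asymptotics)

import Data.Nat as ℕ
open import Data.Nat.DivMod using (m%n<n; m≡m%n+[m/n]*n)
open import Data.Nat.Divisibility using (_∣_; divides)
open import Data.Integer using (+_)
import Data.Integer as ℤ
import Data.Integer.Properties as ℤₚ
open import Data.Rational using (ℚ; mkℚ; _+_; _/_; _<_; 0ℚ; ↧ₙ_; toℚᵘ; *<*)
import Data.Rational as ℚ
import Data.Rational.Properties as ℚₚ
open import Data.Rational.Unnormalised as ℚᵘ using (mkℚᵘ; *≡*; 0ℚᵘ)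
import Data.Rational.Unnormalised.Properties as ℚᵘₚ

-- A positive ε has numerator at least 1, so it is at least the reciprocal of its denominator. The
-- computation passes through unnormalised rationals, where sums and products are literal fractions
-- without division by a gcd.
clear-denominators : ∀ f d .{{_ : NonZero d}} ε → 0ℚ < ε → ∀ x y →
  ((+ f / d) + ε) ℚ.* toℚ x ℚ.≤ toℚ y → (f ℕ.* ↧ₙ ε ℕ.+ d) ℕ.* x ≤ d ℕ.* ↧ₙ ε ℕ.* y
clear-denominators f (suc d′) ε@(mkℚ (+ zero) e-1 _) (*<* (ℤ.+<+ ())) x y h
clear-denominators f (suc d′) ε@(mkℚ (+ suc a) e-1 _) ε>0 x y h = begin
  (f ℕ.* e ℕ.+ d) ℕ.* x               ≤⟨ *-monoˡ-≤ x (+-monoʳ-≤ (f ℕ.* e) (m≤n*m d (suc a))) ⟩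
  (f ℕ.* e ℕ.+ suc a ℕ.* d) ℕ.* x     ≡⟨ sym (*-identityʳ _) ⟩
  (f ℕ.* e ℕ.+ suc a ℕ.* d) ℕ.* x ℕ.* 1 ≤⟨ ℤₚ.drop‿+≤+ (subst₂ ℤ._≤_ lhs rhs (ℚᵘₚ.drop-*≤* unnormalised)) ⟩
  y ℕ.* (d ℕ.* e ℕ.* 1)               ≡⟨ ring y (d ℕ.* e) ⟩
  d ℕ.* e ℕ.* y                       ∎
  where
  open ≤-Reasoning
  e d : ℕ
  e = suc e-1
  d = suc d′
  ring : ∀ y z → y ℕ.* (z ℕ.* 1) ≡ z ℕ.* y
  ring = solve-∀
  unnormalised : (mkℚᵘ (+ f) d′ ℚᵘ.+ mkℚᵘ (+ suc a) e-1) ℚᵘ.* mkℚᵘ (+ x) 0 ℚᵘ.≤ mkℚᵘ (+ y) 0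
  unnormalised = ℚᵘₚ.≤-respˡ-≃ {mkℚᵘ (+ y) 0} hom (ℚᵘₚ.≤-respʳ-≃ (ℚₚ.toℚᵘ-fromℚᵘ (mkℚᵘ (+ y) 0)) (ℚₚ.toℚᵘ-mono-≤ h))
    where
    hom : toℚᵘ (((+ f / d) + ε) ℚ.* toℚ x) ℚᵘ.≃ (mkℚᵘ (+ f) d′ ℚᵘ.+ mkℚᵘ (+ suc a) e-1) ℚᵘ.* mkℚᵘ (+ x) 0
    hom = ℚᵘₚ.≃-trans (ℚₚ.toℚᵘ-homo-* ((+ f / d) + ε) (toℚ x))
      (ℚᵘₚ.*-cong
        (ℚᵘₚ.≃-trans (ℚₚ.toℚᵘ-homo-+ (+ f / d) ε) (ℚᵘₚ.+-congˡ (mkℚᵘ (+ suc a) e-1) (ℚₚ.toℚᵘ-fromℚᵘ (mkℚᵘ (+ f) d′))))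
        (ℚₚ.toℚᵘ-fromℚᵘ (mkℚᵘ (+ x) 0)))
  lhs : (+ f ℤ.* + e ℤ.+ + suc a ℤ.* + d) ℤ.* + x ℤ.* + 1 ≡ + ((f ℕ.* e ℕ.+ suc a ℕ.* d) ℕ.* x ℕ.* 1)
  lhs = trans (cong (λ z → z ℤ.* + x ℤ.* + 1) (cong₂ ℤ._+_ (sym (ℤₚ.pos-* f e)) (sym (ℤₚ.pos-* (suc a) d))))
    (trans (cong (ℤ._* + 1) (sym (ℤₚ.pos-* (f ℕ.* e ℕ.+ suc a ℕ.* d) x))) (sym (ℤₚ.pos-* ((f ℕ.* e ℕ.+ suc a ℕ.* d) ℕ.* x) 1)))
  rhs : + y ℤ.* (+ (d ℕ.* e ℕ.* 1)) ≡ + (y ℕ.* (d ℕ.* e ℕ.* 1))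
  rhs = sym (ℤₚ.pos-* y _)
clear-denominators f (suc d′) (mkℚ (ℤ.-[1+ _ ]) e-1 _) (*<* ()) x y h

lower-bound : ∀ d .{{_ : NonZero d}} s flag → d ≡ s ℕ.* 2 ℕ.+ ind flag → ∀ k → 1 ≤ k → ∀ ε → 0ℚ < ε →
  ∀ (T : ℕ → ℕ) (A : (n : ℕ) → LocalAlg k n (T n)) →
  ApproxFamily d k ((+ (2 ℕ.* ind flag) / d) + ε) T A → OmegaLogStar d T
lower-bound d s flag refl k k≥1 ε@record{} ε>0 T A approx = height 1 , suc (size-bound 0) , bound
  where
  open Asymptotics s flag (↧ₙ ε) using (height; logStar-linear)
  open Parameters s flag (↧ₙ ε) using (size-bound; bounded-size)
  bound : ∀ n → suc (size-bound 0) ≤ n → _ → logStar n ≤ height 1 ℕ.* T n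
  bound n n≥ (G₀ , cl) with class⇒even G₀ cl
  ... | m , n≡ = logStar-linear (T n) n n≥ (bounded-size (T n) k≥1 m n≡ (A n) λ G id clG val S′ →
        clear-denominators (2 ℕ.* ind flag) d ε ε>0 _ _ (approx n G id clG val S′))

theorem3 : (d : ℕ) .{{_ : NonZero d}} → (k : ℕ) → 1 ≤ k →
    (2 ∣ d → ∀ (ρ : ℚ) → 0ℚ < ρ → ∀ (T : ℕ → ℕ) (A : (n : ℕ) → LocalAlg k n (T n)) →
    ApproxFamily d k ρ T A → OmegaLogStar d T)
    × (¬ (2 ∣ d) → ∀ (ε : ℚ) → 0ℚ < ε → ∀ (T : ℕ → ℕ) (A : (n : ℕ) → LocalAlg k n (T n)) →
    ApproxFamily d k ((+ 2 / d) + ε) T A → OmegaLogStar d T)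
theorem3 d k k≥1 = even , odd-case
  where
  even : 2 ∣ d → ∀ ρ → 0ℚ < ρ → ∀ (T : ℕ → ℕ) (A : (n : ℕ) → LocalAlg k n (T n)) → ApproxFamily d k ρ T A → OmegaLogStar d T
  even (divides s d≡) ρ ρ>0 T A approx = lower-bound d s false (trans d≡ (sym (+-identityʳ _))) k k≥1 ρ ρ>0 T A
    -- For even d the threshold is 0/d, so the given ρ, rewritten as 0/d + ρ, takes the place of ε.
    (subst (λ σ → ApproxFamily d k σ T A) (sym (trans (cong (_+ ρ) (0/ d)) (ℚₚ.+-identityˡ ρ))) approx)
    where
    0/ : ∀ d .{{_ : NonZero d}} → + 0 / d ≡ 0ℚ
    0/ (suc d′) = ℚₚ.fromℚᵘ-cong {mkℚᵘ (+ 0) d′} {0ℚᵘ} (*≡* refl)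
  odd-case : ¬ (2 ∣ d) → ∀ ε → 0ℚ < ε → ∀ (T : ℕ → ℕ) (A : (n : ℕ) → LocalAlg k n (T n)) → ApproxFamily d k ((+ 2 / d) + ε) T A → OmegaLogStar d T
  odd-case ¬2∣d ε ε>0 T A approx with d ℕ.% 2 in e | m%n<n d 2 | m≡m%n+[m/n]*n d 2
  ... | zero        | _ | d≡ = contradiction (divides (d ℕ./ 2) d≡) ¬2∣d
  ... | suc zero    | _ | d≡ = lower-bound d (d ℕ./ 2) true (trans d≡ (+-comm 1 _)) k k≥1 ε ε>0 T A approx
  ... | suc (suc _) | s≤s (s≤s ()) | _
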